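{- Let $2\le k\le n$ and let $D$ be a strong digraph of order $n$. Then $1\le \lambda_k(D)\le n-1$. Moreover, both bounds are sharp, and $\lambda_k(D)=n-1$ holds if and only if $D\cong\overleftrightarrow{K}_n$ and either $k\notin\{4,6\}$, or $k\in\{4,6\}$ and $k<n$.
   Context: Digraphs are finite, without loops or parallel arcs; strong means strongly connected. $\overleftrightarrow{K}_n$ is the complete digraph on $n$ vertices. For $S\subseteq V(D)$, $\lambda_S(D)$ is the maximum number of pairwise arc-disjoint strong subgraphs of $D$ containing $S$, and $\lambda_k(D)=\min\{\lambda_S(D): S\subseteq V(D), |S|=k\}$. -}

module Defs where

open import Data.Bool using (true; false)
import Data.Bool.Properties as Bool
open import Data.Empty using (⊥-elim)
open import Data.Fin using (Fin)
import Data.Fin.Properties as Fin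
open import Data.Fin.Permutation using (Permutation; _⟨$⟩ʳ_)
open import Data.Fin.Subset as Subset using (Subset; ∣_∣; inside; outside)
import Data.Fin.Subset.Properties as Subset
open import Data.List using (List; []; _∷_; _++_; map; filter; length; cartesianProductWith; allFin)
open import Data.List.Extrema.Nat using (min; max; min≤⊤; min≤xs; xs≤max; argmin-sel; argmax-sel)
open import Data.List.Properties using (length-++)
open import Data.List.Membership.Propositional using (_∈_)
open import Data.List.Membership.Propositional.Properties using (∈-cartesianProductWith⁺; ∈-map⁺; ∈-map⁻; ∈-++⁺ˡ; ∈-++⁺ʳ; ∈-++⁻; ∈-filter⁺; ∈-filter⁻; ∈-allFin; ∈-∃++)
import Data.List.Membership.DecPropositional as DecMembership
open import Data.List.Relation.Unary.All as All using (All; []; _∷_)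
open import Data.List.Relation.Unary.AllPairs as AllPairs using (AllPairs; []; _∷_)
open import Data.List.Relation.Unary.Any using (here; there)
open import Data.List.Relation.Unary.Unique.Propositional using (Unique)
import Data.List.Relation.Unary.Unique.Propositional.Properties as Unique
open import Data.Nat using (ℕ; zero; suc; _≤_; z≤n; s≤s)
import Data.Nat.Properties as ℕ
open import Data.Product using (∃-syntax; _×_; _,_; proj₂)
open import Data.Sum using (_⊎_; inj₁; inj₂)
open import Data.Vec as Vec using (Vec; []; _∷_)
import Data.Vec.Properties as Vec
open import Function using (id)
open import Function.Bundles using (_⇔_)
open import Level using (0ℓ)
open import Relation.Binary using (Rel; Decidable; DecidableEquality)
open import Relation.Binary.Construct.Closure.ReflexiveTransitive using (Star; ε; _◅_; _◅◅_)
open import Relation.Binary.PropositionalEquality using (_≡_; _≢_; refl; sym; trans; cong)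
open import Relation.Nullary using (¬_; Dec; yes; no)
open import Relation.Nullary.Decidable using (map′; _×-dec_; _⊎-dec_; _→-dec_; ¬?)

------------------------------------------------------------------------
-- Digraphs of order n, with vertex set Fin n

-- Decidability of arcs is what makes such a digraph a finite object; arcs
-- are compared only through inhabitation of Arc, so there is no
-- multiplicity.
record Digraph (n : ℕ) : Set₁ where
  field
    Arc      : Rel (Fin n) 0ℓ
    arc?     : Decidable Arc
    loopless : ∀ v → ¬ Arc v v

open Digraph public

Strong : ∀ {n} → Digraph n → Set
Strong D = ∀ u v → Star (Arc D) u v

record _≅_ {m n} (D : Digraph m) (E : Digraph n) : Set where
  field
    bijection : Permutation m n
    preserves : ∀ u v → Arc D u v ⇔ Arc E (bijection ⟨$⟩ʳ u) (bijection ⟨$⟩ʳ v)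

completeDigraph : ∀ n → Digraph n
completeDigraph n = record
  { Arc      = _≢_
  ; arc?     = λ u v → ¬? (u Fin.≟ v)
  ; loopless = λ v v≢v → v≢v refl
  }

------------------------------------------------------------------------
-- Subgraphs

-- A set of vertices together with, for each u, the set of heads of the
-- arcs leaving u.  The data alone need not be a subgraph of anything; see
-- IsSubgraph.
record Subgraph (n : ℕ) : Set where
  constructor subgraph
  field
    vertices : Subset n
    heads    : Vec (Subset n) n

  ArcOf : Rel (Fin n) 0ℓ
  ArcOf u v = v Subset.∈ Vec.lookup heads u

open Subgraph public

IsSubgraph : ∀ {n} → Digraph n → Subgraph n → Set
IsSubgraph D H = ∀ u v → ArcOf H u v →
  u Subset.∈ vertices H × v Subset.∈ vertices H × Arc D u v

StrongSubgraph : ∀ {n} → Subgraph n → Set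
StrongSubgraph H = ∀ u v → u Subset.∈ vertices H → v Subset.∈ vertices H →
  Star (ArcOf H) u v

ArcDisjoint : ∀ {n} → Rel (Subgraph n) 0ℓ
ArcDisjoint H K = ∀ u v → ¬ (ArcOf H u v × ArcOf K u v)

IsStrongSubgraphContaining : ∀ {n} → Digraph n → Subset n → Subgraph n → Set
IsStrongSubgraphContaining D S H =
  IsSubgraph D H × StrongSubgraph H × S Subset.⊆ vertices H

-- A finite set of pairwise arc-disjoint strong subgraphs of D containing S,
-- listed without repetition.
IsPacking : ∀ {n} → Digraph n → Subset n → List (Subgraph n) → Set
IsPacking D S Hs =
  Unique Hs × All (IsStrongSubgraphContaining D S) Hs × AllPairs ArcDisjoint Hs

------------------------------------------------------------------------
-- Decidability

-- Warshall's algorithm: WalkVia ws u v says that v can be reached from u by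
-- a walk all of whose interior vertices lie in ws.
module _ {n} {R : Rel (Fin n) 0ℓ} (R? : Decidable R) where

  private
    WalkVia : List (Fin n) → Rel (Fin n) 0ℓ
    WalkVia []       u v = u ≡ v ⊎ R u v
    WalkVia (w ∷ ws) u v = WalkVia ws u v ⊎ (WalkVia ws u w × WalkVia ws w v)

    walkVia? : ∀ ws → Decidable (WalkVia ws)
    walkVia? []       u v = (u Fin.≟ v) ⊎-dec R? u v
    walkVia? (w ∷ ws) u v = walkVia? ws u v ⊎-dec (walkVia? ws u w ×-dec walkVia? ws w v)

    sound : ∀ ws {u v} → WalkVia ws u v → Star R u v
    sound []       (inj₁ refl)    = ε
    sound []       (inj₂ r)       = r ◅ ε
    sound (w ∷ ws) (inj₁ p)       = sound ws p
    sound (w ∷ ws) (inj₂ (p , q)) = sound ws p ◅◅ sound ws q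

    base : ∀ ws {u v} → u ≡ v ⊎ R u v → WalkVia ws u v
    base []       p = p
    base (w ∷ ws) p = inj₁ (base ws p)

    join : ∀ {ws u x v} → x ∈ ws → WalkVia ws u x → WalkVia ws x v → WalkVia ws u v
    join (here refl) (inj₁ p)       (inj₁ q)       = inj₂ (p , q)
    join (here refl) (inj₁ p)       (inj₂ (_ , q)) = inj₂ (p , q)
    join (here refl) (inj₂ (p , _)) (inj₁ q)       = inj₂ (p , q)
    join (here refl) (inj₂ (p , _)) (inj₂ (_ , q)) = inj₂ (p , q)
    join (there i)   (inj₁ p)       (inj₁ q)       = inj₁ (join i p q)
    join (there i)   (inj₁ p)       (inj₂ (q , r)) = inj₂ (join i p q , r)
    join (there i)   (inj₂ (p , q)) (inj₁ r)       = inj₂ (p , join i q r)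
    join (there i)   (inj₂ (p , _)) (inj₂ (_ , r)) = inj₂ (p , r)

    complete : ∀ {u v} → Star R u v → WalkVia (allFin n) u v
    complete ε        = base (allFin n) (inj₁ refl)
    complete (r ◅ rs) = join (∈-allFin _) (base (allFin n) (inj₂ r)) (complete rs)

  star? : Decidable (Star R)
  star? u v = map′ (sound (allFin n)) complete (walkVia? (allFin n) u v)

arcOf? : ∀ {n} (H : Subgraph n) → Decidable (ArcOf H)
arcOf? H u v = v Subset.∈? Vec.lookup (heads H) u

infix 4 _≟ˢ_

_≟ˢ_ : ∀ {n} → DecidableEquality (Subgraph n)
subgraph V A ≟ˢ subgraph W B =
  map′ (λ { (refl , refl) → refl }) (λ { refl → refl , refl })
    (Vec.≡-dec Bool._≟_ V W ×-dec Vec.≡-dec (Vec.≡-dec Bool._≟_) A B)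

isSubgraph? : ∀ {n} (D : Digraph n) H → Dec (IsSubgraph D H)
isSubgraph? D H = Fin.all? λ u → Fin.all? λ v → arcOf? H u v →-dec
  ((u Subset.∈? vertices H) ×-dec ((v Subset.∈? vertices H) ×-dec arc? D u v))

strongSubgraph? : ∀ {n} (H : Subgraph n) → Dec (StrongSubgraph H)
strongSubgraph? H = Fin.all? λ u → Fin.all? λ v →
  (u Subset.∈? vertices H) →-dec ((v Subset.∈? vertices H) →-dec star? (arcOf? H) u v)

arcDisjoint? : ∀ {n} → Decidable (ArcDisjoint {n})
arcDisjoint? H K = Fin.all? λ u → Fin.all? λ v → ¬? (arcOf? H u v ×-dec arcOf? K u v)

isPacking? : ∀ {n} (D : Digraph n) S Hs → Dec (IsPacking D S Hs)
isPacking? D S Hs =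
  AllPairs.allPairs? (λ H K → ¬? (H ≟ˢ K)) Hs ×-dec
  (All.all? (λ H → isSubgraph? D H ×-dec (strongSubgraph? H ×-dec (S Subset.⊆? vertices H))) Hs ×-dec
   AllPairs.allPairs? arcDisjoint? Hs)

------------------------------------------------------------------------
-- Enumerations

vectors : ∀ {A : Set} → List A → ∀ m → List (Vec A m)
vectors xs zero    = [] ∷ []
vectors xs (suc m) = cartesianProductWith _∷_ xs (vectors xs m)

subsets : ∀ n → List (Subset n)
subsets n = vectors (inside ∷ outside ∷ []) n

subgraphs : ∀ n → List (Subgraph n)
subgraphs n = cartesianProductWith subgraph (subsets n) (vectors (subsets n) n)

sublists : ∀ {A : Set} → List A → List (List A)
sublists []       = [] ∷ []
sublists (x ∷ xs) = map (x ∷_) (sublists xs) ++ sublists xs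

------------------------------------------------------------------------
-- Strong subgraph k-arc-connectivity

λ-set : ∀ {n} → Digraph n → Subset n → ℕ
λ-set {n} D S = max 0 (map length (filter (isPacking? D S) (sublists (subgraphs n))))

-- The value at [] is junk; it is reached by λ-arc only for k > n.
minimum : List ℕ → ℕ
minimum []       = 0
minimum (x ∷ xs) = min x xs

λ-arc : ∀ {n} → ℕ → Digraph n → ℕ
λ-arc {n} k D = minimum (map (λ-set D) (filter (λ S → ∣ S ∣ ℕ.≟ k) (subsets n)))

------------------------------------------------------------------------
-- The enumerations are exhaustive, so λ-set and λ-arc are the maximum and
-- the minimum they are meant to be.

∈-vectors : ∀ {A : Set} {xs : List A} → (∀ x → x ∈ xs) → ∀ {m} (v : Vec A m) → v ∈ vectors xs m
∈-vectors all []      = here refl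
∈-vectors all (x ∷ v) = ∈-cartesianProductWith⁺ _∷_ (all x) (∈-vectors all v)

∈-subsets : ∀ {n} (S : Subset n) → S ∈ subsets n
∈-subsets = ∈-vectors λ { true → here refl ; false → there (here refl) }

∈-subgraphs : ∀ {n} (H : Subgraph n) → H ∈ subgraphs n
∈-subgraphs (subgraph V A) =
  ∈-cartesianProductWith⁺ subgraph (∈-subsets V) (∈-vectors ∈-subsets A)

vectors-unique : ∀ {A : Set} {xs : List A} → Unique xs → ∀ m → Unique (vectors xs m)
vectors-unique u zero    = [] ∷ []
vectors-unique u (suc m) =
  Unique.cartesianProductWith⁺ _∷_ Vec.∷-injective u (vectors-unique u m)

subsets-unique : ∀ n → Unique (subsets n)
subsets-unique n = vectors-unique (((λ ()) ∷ []) ∷ [] ∷ []) n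

subgraphs-unique : ∀ n → Unique (subgraphs n)
subgraphs-unique n =
  Unique.cartesianProductWith⁺ subgraph (λ { refl → refl , refl })
    (subsets-unique n) (vectors-unique (subsets-unique n) n)

filter∈sublists : ∀ {A : Set} {P : A → Set} (P? : ∀ x → Dec (P x)) xs → filter P? xs ∈ sublists xs
filter∈sublists P? []       = here refl
filter∈sublists P? (x ∷ xs) with P? x
... | yes _ = ∈-++⁺ˡ (∈-map⁺ (x ∷_) (filter∈sublists P? xs))
... | no  _ = ∈-++⁺ʳ (map (x ∷_) (sublists xs)) (filter∈sublists P? xs)

unique-length-≤ : ∀ {A : Set} {xs ys : List A} → Unique xs → (∀ {x} → x ∈ xs → x ∈ ys) → length xs ≤ length ys
unique-length-≤ {xs = []}     _        _   = z≤n
unique-length-≤ {xs = x ∷ xs} (px ∷ u) sub with ∈-∃++ (sub (here refl))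
... | as , bs , refl = ℕ.≤-trans (s≤s (unique-length-≤ u sub′)) (ℕ.≤-reflexive eq)
  where
  sub′ : ∀ {y} → y ∈ xs → y ∈ as ++ bs
  sub′ y∈xs with ∈-++⁻ as (sub (there y∈xs))
  ... | inj₁ i            = ∈-++⁺ˡ i
  ... | inj₂ (here refl)  = ⊥-elim (All.lookup px y∈xs refl)
  ... | inj₂ (there i)    = ∈-++⁺ʳ as i
  eq : suc (length (as ++ bs)) ≡ length (as ++ x ∷ bs)
  eq = trans (cong suc (length-++ as)) (trans (sym (ℕ.+-suc (length as) (length bs))) (sym (length-++ as)))

private
  allPairs⇒ : ∀ {A : Set} {R : Rel A 0ℓ} → (∀ {x y} → R x y → R y x) →
    ∀ {xs} → AllPairs R xs → ∀ {x y} → x ∈ xs → y ∈ xs → x ≢ y → R x y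
  allPairs⇒ s (_ ∷ _)  (here refl) (here refl) x≢y = ⊥-elim (x≢y refl)
  allPairs⇒ s (r ∷ _)  (here refl) (there j)   _   = All.lookup r j
  allPairs⇒ s (r ∷ _)  (there i)   (here refl) _   = s (All.lookup r i)
  allPairs⇒ s (_ ∷ rs) (there i)   (there j)   x≢y = allPairs⇒ s rs i j x≢y

  ⇒allPairs : ∀ {A : Set} {R : Rel A 0ℓ} {xs} → Unique xs →
    (∀ {x y} → x ∈ xs → y ∈ xs → x ≢ y → R x y) → AllPairs R xs
  ⇒allPairs []       f = []
  ⇒allPairs (p ∷ ps) f =
    All.tabulate (λ i → f (here refl) (there i) (All.lookup p i)) ∷
    ⇒allPairs ps (λ i j → f (there i) (there j))

λ-set-attained : ∀ {n} (D : Digraph n) S → ∃[ Hs ] (IsPacking D S Hs × length Hs ≡ λ-set D S)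
λ-set-attained {n} D S
  with argmax-sel id 0 (map length (filter (isPacking? D S) (sublists (subgraphs n))))
... | inj₁ eq = [] , ([] , [] , []) , sym eq
... | inj₂ i with ∈-map⁻ length i
... | Hs , j , eq = Hs , proj₂ (∈-filter⁻ (isPacking? D S) {xs = sublists (subgraphs n)} j) , sym eq

λ-set-upper : ∀ {n} (D : Digraph n) S {Hs} → IsPacking D S Hs → length Hs ≤ λ-set D S
λ-set-upper {n} D S {Hs} (uniq , strong , disj) =
  ℕ.≤-trans (unique-length-≤ uniq (λ i → ∈-filter⁺ (_∈? Hs) (∈-subgraphs _) i))
    (All.lookup (xs≤max 0 _)
      (∈-map⁺ length (∈-filter⁺ (isPacking? D S) (filter∈sublists (_∈? Hs) (subgraphs n)) packing)))
  where
  open DecMembership _≟ˢ_ using (_∈?_)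
  Ks : List (Subgraph n)
  Ks = filter (_∈? Hs) (subgraphs n)
  back : ∀ {K} → K ∈ Ks → K ∈ Hs
  back i = proj₂ (∈-filter⁻ (_∈? Hs) {xs = subgraphs n} i)
  uniqK : Unique Ks
  uniqK = Unique.filter⁺ (_∈? Hs) (subgraphs-unique n)
  packing : IsPacking D S Ks
  packing = uniqK
    , All.tabulate (λ i → All.lookup strong (back i))
    , ⇒allPairs uniqK (λ i j → allPairs⇒ (λ d u v (a , b) → d u v (b , a)) disj (back i) (back j))

minimum-lower : ∀ {x} xs → x ∈ xs → minimum xs ≤ x
minimum-lower (x ∷ xs) (here refl) = min≤⊤ x xs
minimum-lower (x ∷ xs) (there i)   = All.lookup (min≤xs x xs) i

minimum-attained : ∀ {x} xs → x ∈ xs → minimum xs ∈ xs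
minimum-attained (x ∷ xs) _ with argmin-sel id x xs
... | inj₁ eq = here eq
... | inj₂ i  = there i

subset-of-size : ∀ {n k} → k ≤ n → ∃[ S ] ∣_∣ {n} S ≡ k
subset-of-size {n} {zero} z≤n = Subset.⊥ , Subset.∣⊥∣≡0 n
subset-of-size (s≤s k≤n) with subset-of-size k≤n
... | S , eq = inside ∷ S , cong suc eq

λ-arc-lower : ∀ {n} k (D : Digraph n) S → ∣ S ∣ ≡ k → λ-arc k D ≤ λ-set D S
λ-arc-lower k D S eq =
  minimum-lower _ (∈-map⁺ (λ-set D) (∈-filter⁺ (λ T → ∣ T ∣ ℕ.≟ k) (∈-subsets S) eq))

λ-arc-attained : ∀ {n k} (D : Digraph n) → k ≤ n → ∃[ S ] (∣ S ∣ ≡ k × λ-set D S ≡ λ-arc k D)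
λ-arc-attained {n} {k} D k≤n with subset-of-size k≤n
... | S , eq with ∈-map⁻ (λ-set D) (minimum-attained _
                    (∈-map⁺ (λ-set D) (∈-filter⁺ (λ T → ∣ T ∣ ℕ.≟ k) (∈-subsets S) eq)))
... | T , i , e = T , proj₂ (∈-filter⁻ (λ U → ∣ U ∣ ℕ.≟ k) {xs = subsets n} i) , sym e

{-# OPTIONS --safe #-}

-- Upper bound: the strong subgraphs of a packing for S leave a vertex of S
-- through different arcs, and if there are n - 1 of them then all arcs from
-- that vertex are present.
--
-- The complete digraph: it suffices to colour the arcs with n - 1 colours so
-- that every colour class is strong and spanning.  For n = 2t + 1 Walecki's
-- zigzag cycles do this; they are the classes of an explicit colour function
-- on the vertices 0, ..., 2t - 1, ∞ = 2t.  For n = 2t + 2 ≥ 8 the Walecki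
-- colouring has a rainbow Hamiltonian path P: from ∞ to 0, then in steps of 2
-- except for t - 3 → t + 1, t - 2 → t - 1 → t, 2t - 2 → 2t - 1 → 1, up to
-- 2t - 3.  A new vertex ω is inserted into each cycle at the arc of P of that
-- colour, and the arcs of P, closed up through ω, are the remaining cycle.
-- For n = 4 or 6 and k < n, take Walecki's cycles on the vertices other than
-- some v outside S, together with the star at v.
--
-- For k = n each of n - 1 subgraphs has one arc out of every vertex, so it is
-- a Hamiltonian cycle, and an exhaustive search excludes n = 4 and n = 6.
module Submission where

open import Data.Bool using (Bool; true; false; if_then_else_; _xor_)
open import Data.Bool.ListAction using (all)
open import Data.Bool.Properties using (T-≡)
open import Data.Fin using (Fin; zero; suc; toℕ; fromℕ<; punchIn; punchOut)
import Data.Fin.Permutation as Permutation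
import Data.Fin.Properties as Fin
open import Data.Fin.Subset as Subset using (Subset; ∣_∣; ⊤; ∁; ⁅_⁆; inside; outside)
import Data.Fin.Subset.Properties as Subset
open import Data.List as List using (List; []; _∷_; allFin; cartesianProductWith; filter; length)
open import Data.List.Membership.Propositional using (_∈_; _∉_)
open import Data.List.Membership.Propositional.Properties using (∈-allFin; ∈-cartesianProductWith⁺; ∈-filter⁺; ∈-lookup)
import Data.List.Membership.DecPropositional as DecMembership
open import Data.List.Properties using (length-tabulate)
open import Data.List.Relation.Unary.All as All using (All; []; _∷_)
import Data.List.Relation.Unary.All.Properties as All
open import Data.List.Relation.Unary.AllPairs using (AllPairs; []; _∷_)
import Data.List.Relation.Unary.AllPairs.Properties as AllPairs
open import Data.List.Relation.Unary.Any using (here; there)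
import Data.List.Relation.Unary.Unique.Propositional.Properties as Unique
open import Data.Nat using (ℕ; zero; suc; _+_; _∸_; _≤_; _<_; z≤n; s≤s; s≤s⁻¹; _<?_; _≟_)
import Data.Nat.Properties as ℕ
open import Data.Nat.Tactic.RingSolver using (solve-∀)
open import Data.Product using (_×_; _,_; ∃; ∃₂; ∃-syntax; map₂; proj₁; proj₂)
open import Data.Sum using (_⊎_; inj₁; inj₂)
open import Data.Vec as Vec using (Vec; []; _∷_)
import Data.Vec.Properties as Vec
open import Function using (id; _∘_)
open import Function.Bundles using (_⇔_; mk⇔; Equivalence)
open import Function.Definitions using (Injective)
open import Level using (0ℓ)
open import Relation.Binary using (Rel; Decidable)
open import Relation.Binary.Construct.Closure.ReflexiveTransitive as Star using (Star; ε; _◅_; _◅◅_; kleisliStar)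
open import Relation.Binary.PropositionalEquality using (_≡_; _≢_; refl; sym; trans; cong; subst; subst₂)
open import Relation.Nullary using (¬_; Dec; yes; no; does; contradiction)
open import Relation.Nullary.Decidable using (dec-true; dec-false; ¬?; _×-dec_; _⊎-dec_; _→-dec_)
open import Defs

-- Arc colourings with strong classes

Class : ℕ → (ℕ → ℕ → ℕ) → ℕ → Rel ℕ 0ℓ
Class n c i u v = u < n × v < n × u ≢ v × c u v ≡ i

-- Vertices are natural numbers, so that adjacency becomes plain arithmetic; `class⇒colourArc`
-- carries the walks over to `Fin`.
StrongColouring : ℕ → (ℕ → ℕ → ℕ) → Set
StrongColouring q c = ∀ {i} → i < q → ∀ {u v} → u < suc q → v < suc q →
  Star (Class (suc q) c i) u v

-- An explicit difference turns an inequality between symbolic vertices into an equation for the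
-- ring solver.
<-offset : ∀ {m n} k → suc m + k ≡ n → m < n
<-offset {m} k eq = subst (m <_) eq (s≤s (ℕ.m≤m+n m k))

offset : ∀ {m n} → m ≤ n → ∃ λ k → n ≡ m + k
offset {m} {n} m≤n = n ∸ m , sym (ℕ.m+[n∸m]≡n m≤n)

below-or-above : ∀ s x → x < s ⊎ ∃ λ k → x ≡ k + s
below-or-above s x with x <? s
... | yes x<s = inj₁ x<s
... | no  x≮s = inj₂ (x ∸ s , sym (ℕ.m∸n+n≡m (ℕ.≮⇒≥ x≮s)))

-- Walecki's colouring

antipode : ℕ → ℕ → ℕ
antipode t h = if does (h <? t) then h + t else h ∸ t

antipode-< : ∀ {t h} → h < t → antipode t h ≡ h + t
antipode-< {t} {h} h<t rewrite dec-true (h <? t) h<t = refl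

antipode-+ : ∀ t h → antipode t (h + t) ≡ h
antipode-+ t h rewrite dec-false (h + t <? t) (ℕ.m+n≮n h t) = ℕ.m+n∸n≡m h t

halve : ℕ → Bool × ℕ
halve 0             = false , 0
halve 1             = true  , 0
halve (suc (suc x)) = map₂ suc (halve x)

halve-even : ∀ h → halve (h + h) ≡ (false , h)
halve-even zero = refl
halve-even (suc h) rewrite ℕ.+-suc h h | halve-even h = refl

halve-odd : ∀ h → halve (suc (h + h)) ≡ (true , h)
halve-odd zero = refl
halve-odd (suc h) rewrite ℕ.+-suc h h | halve-odd h = refl

midpointColour : ℕ → Bool → Bool × ℕ → ℕ
midpointColour t up (odd , h) = if up xor odd then antipode t h else h

-- The zigzag i, i + 1, i - 1, i + 2, ... joins vertices with sum 2i + 1 and 2i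
-- in turn, so the colour of an arc is the midpoint of its ends or the
-- antipode of the midpoint, depending on the direction.
walecki : ℕ → ℕ → ℕ → ℕ
walecki t x y =
  if does (x ≟ t + t) then y else
  if does (y ≟ t + t) then antipode t x else
  midpointColour t (does (x <? y)) (halve (x + y))

module Walecki (t : ℕ) where

  walecki-∞ˡ : ∀ y → walecki t (t + t) y ≡ y
  walecki-∞ˡ y rewrite dec-true (t + t ≟ t + t) refl = refl

  walecki-∞ʳ : ∀ {x} → x < t + t → walecki t x (t + t) ≡ antipode t x
  walecki-∞ʳ {x} x< rewrite dec-false (x ≟ t + t) (ℕ.<⇒≢ x<) | dec-true (t + t ≟ t + t) refl = refl

  walecki-midpoint : ∀ {x y} → x < t + t → y < t + t →
    walecki t x y ≡ midpointColour t (does (x <? y)) (halve (x + y))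
  walecki-midpoint {x} {y} x< y<
    rewrite dec-false (x ≟ t + t) (ℕ.<⇒≢ x<) | dec-false (y ≟ t + t) (ℕ.<⇒≢ y<) = refl

  up-even : ∀ {x y} h → x < y → y < t + t → x + y ≡ h + h → walecki t x y ≡ antipode t h
  up-even {x} {y} h x<y y< eq
    rewrite walecki-midpoint (ℕ.<-trans x<y y<) y< | dec-true (x <? y) x<y | eq | halve-even h = refl

  up-odd : ∀ {x y} h → x < y → y < t + t → x + y ≡ suc (h + h) → walecki t x y ≡ h
  up-odd {x} {y} h x<y y< eq
    rewrite walecki-midpoint (ℕ.<-trans x<y y<) y< | dec-true (x <? y) x<y | eq | halve-odd h = refl

  down-even : ∀ {x y} h → y < x → x < t + t → x + y ≡ h + h → walecki t x y ≡ h
  down-even {x} {y} h y<x x< eq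
    rewrite walecki-midpoint x< (ℕ.<-trans y<x x<) | dec-false (x <? y) (ℕ.<-asym y<x) | eq | halve-even h = refl

  down-odd : ∀ {x y} h → y < x → x < t + t → x + y ≡ suc (h + h) → walecki t x y ≡ antipode t h
  down-odd {x} {y} h y<x x< eq
    rewrite walecki-midpoint x< (ℕ.<-trans y<x x<) | dec-false (x <? y) (ℕ.<-asym y<x) | eq | halve-odd h = refl

-- The parameter e stands for t - 1 - i. This encodes i < t and keeps subtraction out of the
-- identities below.
module WaleckiCycle (i e : ℕ) where

  t ∞ : ℕ
  t = suc (i + e)
  ∞ = t + t

  open Walecki t

  -- Colour i + t is colour i reversed.
  Edge : Rel ℕ 0ℓ
  Edge u v = Class (suc ∞) (walecki t) i u v × Class (suc ∞) (walecki t) (i + t) v u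

  antipode-i : antipode t i ≡ i + t
  antipode-i = antipode-< (s≤s (ℕ.m≤m+n i e))

  edge : ∀ {u v} → u < suc ∞ → v < suc ∞ → u ≢ v → walecki t u v ≡ i → walecki t v u ≡ i + t → Edge u v
  edge u< v< u≢v p q = (u< , v< , u≢v , p) , (v< , u< , u≢v ∘ sym , q)

  -- Modulo 2t the sums along the zigzag are 2i + 1 and 2i. As integers, 2i + 2t and 2i + 2t + 1
  -- occur as well; there the midpoint moves to its antipode, so upward and downward arcs exchange
  -- roles.
  up-odd-edge : ∀ {x y} → x < y → y < ∞ → x + y ≡ suc (i + i) → Edge x y
  up-odd-edge {x} {y} x<y y< eq =
    edge (ℕ.m<n⇒m<1+n (ℕ.<-trans x<y y<)) (ℕ.m<n⇒m<1+n y<) (ℕ.<⇒≢ x<y)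
      (up-odd i x<y y< eq)
      (trans (down-odd i x<y y< (trans (ℕ.+-comm y x) eq)) antipode-i)

  down-even-edge : ∀ {x y} → y < x → x < ∞ → x + y ≡ i + i → Edge x y
  down-even-edge {x} {y} y<x x< eq =
    edge (ℕ.m<n⇒m<1+n x<) (ℕ.m<n⇒m<1+n (ℕ.<-trans y<x x<)) (ℕ.>⇒≢ y<x)
      (down-even i y<x x< eq)
      (trans (up-even i y<x x< (trans (ℕ.+-comm y x) eq)) antipode-i)

  up-even-edge : ∀ {x y} → x < y → y < ∞ → x + y ≡ (i + t) + (i + t) → Edge x y
  up-even-edge {x} {y} x<y y< eq =
    edge (ℕ.m<n⇒m<1+n (ℕ.<-trans x<y y<)) (ℕ.m<n⇒m<1+n y<) (ℕ.<⇒≢ x<y)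
      (trans (up-even (i + t) x<y y< eq) (antipode-+ t i))
      (down-even (i + t) x<y y< (trans (ℕ.+-comm y x) eq))

  down-odd-edge : ∀ {x y} → y < x → x < ∞ → x + y ≡ suc ((i + t) + (i + t)) → Edge x y
  down-odd-edge {x} {y} y<x x< eq =
    edge (ℕ.m<n⇒m<1+n x<) (ℕ.m<n⇒m<1+n (ℕ.<-trans y<x x<)) (ℕ.>⇒≢ y<x)
      (trans (down-odd (i + t) y<x x< eq) (antipode-+ t i))
      (up-odd (i + t) y<x x< (trans (ℕ.+-comm y x) eq))

  i<∞ : i < ∞
  i<∞ = <-offset (e + t) (assoc i e)
    where
    assoc : ∀ i e → suc i + (e + suc (i + e)) ≡ suc (i + e) + suc (i + e)
    assoc = solve-∀

  i+t<∞ : i + t < ∞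
  i+t<∞ = <-offset e (assoc i e)
    where
    assoc : ∀ i e → suc (i + suc (i + e)) + e ≡ suc (i + e) + suc (i + e)
    assoc = solve-∀

  first : Edge ∞ i
  first = edge (ℕ.n<1+n ∞) (ℕ.m<n⇒m<1+n i<∞) (ℕ.>⇒≢ i<∞)
    (walecki-∞ˡ i) (trans (walecki-∞ʳ i<∞) antipode-i)

  last : Edge (i + t) ∞
  last = edge (ℕ.m<n⇒m<1+n i+t<∞) (ℕ.n<1+n ∞) (ℕ.<⇒≢ i+t<∞)
    (trans (walecki-∞ʳ i+t<∞) (antipode-+ t i)) (walecki-∞ˡ (i + t))

  -- The cycle is ∞, then i, i + 1, i - 1, i + 2, ..., 0, 2i + 1, then
  -- 2i + 1, 2t - 1, 2i + 2, 2t - 2, ..., i + t.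
  module _ (a j : ℕ) (eq : a + j ≡ i) where

    out : Edge a (suc (i + j))
    out = up-odd-edge
      (s≤s (ℕ.≤-trans (ℕ.m≤m+n a j) (subst (_≤ i + j) (sym eq) (ℕ.m≤m+n i j))))
      (<-offset (a + e + e) (subst (λ i → suc (suc (i + j)) + (a + e + e) ≡ suc (i + e) + suc (i + e)) eq (bound a j e)))
      (subst (λ i → a + suc (i + j) ≡ suc (i + i)) eq (sum a j))
      where
      bound : ∀ a j e → suc (suc ((a + j) + j)) + (a + e + e) ≡ suc ((a + j) + e) + suc ((a + j) + e)
      bound = solve-∀
      sum : ∀ a j → a + suc ((a + j) + j) ≡ suc ((a + j) + (a + j))
      sum = solve-∀

  back : ∀ a j → suc a + j ≡ i → Edge (suc (i + j)) a
  back a j refl = down-even-edge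
      (<-offset (suc (j + j)) (less a j))
      (<-offset (suc a + e + e) (bound a j e))
      (sum a j)
    where
    less : ∀ a j → suc a + suc (j + j) ≡ suc (suc a + j + j)
    less = solve-∀
    bound : ∀ a j e → suc (suc ((suc a + j) + j)) + (suc a + e + e) ≡ suc ((suc a + j) + e) + suc ((suc a + j) + e)
    bound = solve-∀
    sum : ∀ a j → suc ((suc a + j) + j) + a ≡ (suc a + j) + (suc a + j)
    sum = solve-∀

  -- The two halves of the second part are 2i + 1 + b and 2i + 1 + e + f,
  -- paired by b + f ≡ e.
  lower upper : ℕ → ℕ
  lower b = suc (i + i) + b
  upper f = suc (i + i) + (e + f)

  upper<∞ : ∀ {f} b → b + f ≡ e → upper f < ∞
  upper<∞ {f} b refl = <-offset b (bound i b f)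
    where
    bound : ∀ i b f → suc (suc (i + i) + (b + f + f)) + b ≡ suc (i + (b + f)) + suc (i + (b + f))
    bound = solve-∀

  out₂ : ∀ b f → b + suc f ≡ e → Edge (lower b) (upper (suc f))
  out₂ b f refl = up-even-edge
      (<-offset (suc (f + f)) (less i b f))
      (upper<∞ b refl)
      (sum i b f)
    where
    less : ∀ i b f → suc (suc (i + i) + b) + suc (f + f) ≡ suc (i + i) + (b + suc f + suc f)
    less = solve-∀
    sum : ∀ i b f → suc (i + i) + b + (suc (i + i) + (b + suc f + suc f))
                  ≡ i + suc (i + (b + suc f)) + (i + suc (i + (b + suc f)))
    sum = solve-∀

  back₂ : ∀ b f → b + suc f ≡ e → Edge (upper (suc f)) (lower (suc b))
  back₂ b f refl = down-odd-edge
      (<-offset (f + f) (less i b f))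
      (upper<∞ b refl)
      (sum i b f)
    where
    less : ∀ i b f → suc (suc (i + i) + suc b) + (f + f) ≡ suc (i + i) + (b + suc f + suc f)
    less = solve-∀
    sum : ∀ i b f → suc (i + i) + (b + suc f + suc f) + (suc (i + i) + suc b)
                  ≡ suc (i + suc (i + (b + suc f)) + (i + suc (i + (b + suc f))))
    sum = solve-∀

  _⇝_ : Rel ℕ 0ℓ
  _⇝_ = Star Edge

  ∞⇝a : ∀ a j → a + j ≡ i → ∞ ⇝ a
  ∞⇝a a zero    eq rewrite trans (sym (ℕ.+-identityʳ a)) eq = first ◅ ε
  ∞⇝a a (suc j) eq = ∞⇝a (suc a) j eq′ ◅◅ out (suc a) j eq′ ◅ back a j eq′ ◅ ε
    where eq′ = trans (sym (ℕ.+-suc a j)) eq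

  ∞⇝lower : ∀ b f → b + f ≡ e → ∞ ⇝ lower b
  ∞⇝lower zero    f eq =
    ∞⇝a 0 i refl ◅◅ subst (Edge 0) (sym (ℕ.+-identityʳ _)) (out 0 i refl) ◅ ε
  ∞⇝lower (suc b) f eq = ∞⇝lower b (suc f) eq′ ◅◅ out₂ b f eq′ ◅ back₂ b f eq′ ◅ ε
    where eq′ = trans (ℕ.+-suc b f) eq

  lower⇝∞ : ∀ b f → b + f ≡ e → lower b ⇝ ∞
  lower⇝∞ b zero    eq = subst (λ u → Edge u ∞) (sym lower≡) last ◅ ε
    where
    assoc : ∀ i e → suc (i + i) + e ≡ i + suc (i + e)
    assoc = solve-∀
    lower≡ : lower b ≡ i + t
    lower≡ = trans (cong lower (trans (sym (ℕ.+-identityʳ b)) eq)) (assoc i e)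
  lower⇝∞ b (suc f) eq = out₂ b f eq ◅ back₂ b f eq ◅ lower⇝∞ (suc b) f (trans (sym (ℕ.+-suc b f)) eq)

  a⇝∞ : ∀ a j → a + j ≡ i → a ⇝ ∞
  a⇝∞ zero    j refl = subst (Edge 0) (sym (ℕ.+-identityʳ _)) (out 0 i refl) ◅ lower⇝∞ 0 e refl
  a⇝∞ (suc a) j eq   = out (suc a) j eq ◅ back a j eq ◅ a⇝∞ a (suc j) (trans (ℕ.+-suc a j) eq)

  j⇝∞ : ∀ a j → a + j ≡ i → suc (i + j) ⇝ ∞
  j⇝∞ zero    j refl = subst (_⇝ ∞) (ℕ.+-identityʳ _) (lower⇝∞ 0 e refl)
  j⇝∞ (suc a) j eq   = back a j eq ◅ a⇝∞ a (suc j) (trans (ℕ.+-suc a j) eq)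

  -- Four ranges cover the vertices below ∞: 0 to i and i + 1 to 2i in the first part of the cycle,
  -- `lower` from 2i + 1 to 2i + 1 + e, and `upper` beyond. In each range both walks are pieces of
  -- the cycle.
  through-∞ : ∀ {v} → v < suc ∞ → ∞ ⇝ v × v ⇝ ∞
  through-∞ {v} (s≤s v≤∞) with v ≟ ∞ | v ℕ.≤? i | v ℕ.≤? i + i
  ... | yes refl | _       | _        = ε , ε
  ... | no  _    | yes v≤i | _        = let j , eq = offset v≤i in ∞⇝a v j (sym eq) , a⇝∞ v j (sym eq)
  ... | no  _    | no  v≰i | yes v≤2i with offset (ℕ.≰⇒> v≰i)
  ... | j , refl = ∞⇝a a j eq ◅◅ out a j eq ◅ ε , j⇝∞ a j eq
    where
    j≤i : j ≤ i
    j≤i = ℕ.<⇒≤ (ℕ.+-cancelˡ-≤ i (suc j) i (subst (_≤ i + i) (sym (ℕ.+-suc i j)) v≤2i))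
    a = proj₁ (offset j≤i)
    eq : a + j ≡ i
    eq = trans (ℕ.+-comm a j) (sym (proj₂ (offset j≤i)))
  through-∞ {v} (s≤s v≤∞) | no v≢∞ | no _ | no v≰2i with offset (ℕ.≰⇒> v≰2i)
  ... | w , refl with w ℕ.≤? e
  ... | yes w≤e = let f , eq = offset w≤e in ∞⇝lower w f (sym eq) , lower⇝∞ w f (sym eq)
  ... | no  w≰e with offset (ℕ.≰⇒> w≰e)
  ... | f , refl =
      subst (∞ ⇝_) upper≡ (∞⇝lower b (suc f) eq ◅◅ out₂ b f eq ◅ ε)
    , subst (_⇝ ∞) upper≡ (back₂ b f eq ◅ lower⇝∞ (suc b) f (trans (sym (ℕ.+-suc b f)) eq))
    where
    upper≡ : upper (suc f) ≡ suc (i + i) + suc (e + f)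
    upper≡ = cong (suc (i + i) +_) (ℕ.+-suc e f)
    left : ∀ i e f → suc (suc (i + i) + suc (e + f)) ≡ suc (suc (i + i) + e) + suc f
    left = solve-∀
    right : ∀ i e → suc (i + e) + suc (i + e) ≡ suc (suc (i + i) + e) + e
    right = solve-∀
    f<e : suc f ≤ e
    f<e = ℕ.+-cancelˡ-≤ (suc (suc (i + i) + e)) (suc f) e
      (subst₂ _≤_ (left i e f) (right i e) (ℕ.≤∧≢⇒< v≤∞ v≢∞))
    b = proj₁ (offset f<e)
    eq : b + suc f ≡ e
    eq = trans (ℕ.+-comm b (suc f)) (sym (proj₂ (offset f<e)))

  connected : ∀ {u v} → u < suc ∞ → v < suc ∞ → u ⇝ v
  connected u< v< = proj₂ (through-∞ u<) ◅◅ proj₁ (through-∞ v<)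

-- Each undirected Walecki cycle serves twice: in one direction for a colour i < t, reversed for the
-- colour i + t.
walecki-strong : ∀ t → StrongColouring (t + t) (walecki t)
walecki-strong t {i} i<2t u< v< with below-or-above t i
... | inj₁ i<t with offset i<t
... | e , refl = Star.map proj₁ (WaleckiCycle.connected i e u< v<)
walecki-strong t i<2t u< v< | inj₂ (i , refl) with offset (ℕ.+-cancelʳ-< t i t i<2t)
... | e , refl = Star.reverse proj₂ (WaleckiCycle.connected i e v< u<)

-- Unlike `k + k`, this exposes two successors at once, to match steps of length 2.
twice : ℕ → ℕ
twice zero    = zero
twice (suc k) = 2 + twice k

parity : ∀ x → ∃ λ k → x ≡ twice k ⊎ x ≡ suc (twice k)
parity zero = 0 , inj₁ refl
parity (suc x) with parity x
... | k , inj₁ eq = k , inj₂ (cong suc eq)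
... | k , inj₂ eq = suc k , inj₁ (cong suc eq)

twice≡+ : ∀ k → twice k ≡ k + k
twice≡+ zero    = refl
twice≡+ (suc k) = cong suc (trans (cong suc (twice≡+ k)) (sym (ℕ.+-suc k k)))

-- Inserting a vertex along a rainbow Hamiltonian path

Successor : ℕ → (ℕ → ℕ) → Rel ℕ 0ℓ
Successor n σ u v = u < n × v < n × u ≢ v × σ u ≡ v

-- The new vertex is ω = q + 1. An arc from u to σ u receives the new colour q, and the detour from
-- u over ω to σ u inherits the colour which that arc gives up.
insertVertex : ℕ → (ℕ → ℕ → ℕ) → (ℕ → ℕ) → (ℕ → ℕ) → ℕ → ℕ → ℕ
insertVertex q c σ π u v =
  if does (v ≟ σ u) then q else
  if does (v ≟ suc q) then c u (σ u) else
  if does (u ≟ suc q) then c (π v) v else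
  c u v

module Insert {q : ℕ} {c : ℕ → ℕ → ℕ} {σ π : ℕ → ℕ}
  (strong  : StrongColouring q c)
  (π∘σ     : ∀ {u} → u < suc (suc q) → π (σ u) ≡ u)
  (cyclic  : ∀ {u v} → u < suc (suc q) → v < suc (suc q) → Star (Successor (suc (suc q)) σ) u v)
  (rainbow : ∀ {i} → i < q → ∃ λ u → u < suc q × σ u < suc q × c u (σ u) ≡ i)
  where

  ω : ℕ
  ω = suc q

  c⁺ : ℕ → ℕ → ℕ
  c⁺ = insertVertex q c σ π

  along-path : ∀ u → c⁺ u (σ u) ≡ q
  along-path u rewrite dec-true (σ u ≟ σ u) refl = refl

  into-ω : ∀ {u} → u < ω → σ u < ω → Class (suc ω) c⁺ (c u (σ u)) u ω
  into-ω {u} u< σu< = ℕ.m<n⇒m<1+n u< , ℕ.n<1+n ω , ℕ.<⇒≢ u< , eq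
    where
    eq : c⁺ u ω ≡ c u (σ u)
    eq rewrite dec-false (ω ≟ σ u) (ℕ.>⇒≢ σu<) | dec-true (ω ≟ ω) refl = refl

  from-ω : ∀ {u} → u < ω → σ u < ω → Class (suc ω) c⁺ (c u (σ u)) ω (σ u)
  from-ω {u} u< σu< = ℕ.n<1+n ω , ℕ.m<n⇒m<1+n σu< , ℕ.>⇒≢ σu< , eq
    where
    -- Having the left inverse π, σ is injective, so the arc from ω to σ u is off the closed path
    -- and does not get colour q.
    σu≢σω : σ u ≢ σ ω
    σu≢σω σu≡σω = ℕ.<⇒≢ u<
      (trans (sym (π∘σ (ℕ.m<n⇒m<1+n u<))) (trans (cong π σu≡σω) (π∘σ (ℕ.n<1+n ω))))
    eq : c⁺ ω (σ u) ≡ c u (σ u)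
    eq rewrite dec-false (σ u ≟ σ ω) σu≢σω | dec-false (σ u ≟ ω) (ℕ.<⇒≢ σu<)
             | dec-true (ω ≟ ω) refl | π∘σ (ℕ.m<n⇒m<1+n u<) = refl

  -- An arc of the path has passed to colour q; the two arcs through ω replace it within colour i.
  detour : ∀ {i u v} → Class ω c i u v → Star (Class (suc ω) c⁺ i) u v
  detour {i} {u} {v} (u< , v< , u≢v , refl) with v ≟ σ u
  ... | yes refl = into-ω u< v< ◅ from-ω u< v< ◅ ε
  ... | no  v≢σu = (ℕ.m<n⇒m<1+n u< , ℕ.m<n⇒m<1+n v< , u≢v , eq) ◅ ε
    where
    eq : c⁺ u v ≡ c u v
    eq rewrite dec-false (v ≟ σ u) v≢σu | dec-false (v ≟ ω) (ℕ.<⇒≢ v<) | dec-false (u ≟ ω) (ℕ.<⇒≢ u<) = refl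

  -- By `rainbow` some path arc of colour i was opened up, and this attaches ω to the class in both
  -- directions.
  through-ω : ∀ {i v} → i < q → v < suc ω → Star (Class (suc ω) c⁺ i) ω v × Star (Class (suc ω) c⁺ i) v ω
  through-ω {v = v} i<q (s≤s v≤ω) with rainbow i<q | v ≟ ω
  ... | _                   | yes refl = ε , ε
  ... | u , u< , σu< , refl | no v≢ω   =
      from-ω u< σu< ◅ kleisliStar id detour (strong i<q σu< v<)
    , kleisliStar id detour (strong i<q v< u<) ◅◅ into-ω u< σu< ◅ ε
    where v< = ℕ.≤∧≢⇒< v≤ω v≢ω

  insertVertex-strong : StrongColouring (suc q) c⁺
  insertVertex-strong {i} (s≤s i≤q) u< v< with i ≟ q
  ... | yes refl = Star.map (λ { {x} (x< , y< , x≢y , refl) → x< , y< , x≢y , along-path x }) (cyclic u< v<)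
  ... | no  i≢q  = proj₂ (through-ω i<q u<) ◅◅ proj₁ (through-ω i<q v<)
    where i<q = ℕ.≤∧≢⇒< i≤q i≢q

-- The rainbow path

module RainbowPath (s : ℕ) where

  t q : ℕ
  t = 3 + s
  q = 6 + (s + s)

  t+t≡q : t + t ≡ q
  t+t≡q = assoc s
    where
    assoc : ∀ s → (3 + s) + (3 + s) ≡ 6 + (s + s)
    assoc = solve-∀

  split : (ℕ → ℕ) → (ℕ → ℕ) → ℕ → ℕ
  split f g x = if does (x <? s) then f x else g (x ∸ s)

  split-< : ∀ f g {x} → x < s → split f g x ≡ f x
  split-< f g {x} x<s rewrite dec-true (x <? s) x<s = refl

  split-+ : ∀ f g k → split f g (k + s) ≡ g k
  split-+ f g k rewrite dec-false (k + s <? s) (ℕ.m+n≮n k s) = cong g (ℕ.m+n∸n≡m k s)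

  -- σ is the successor on P closed up through ω = 7 + 2s, and π its inverse.
  -- The exceptional vertices t - 3, t - 2, t - 1 are s, 1 + s, 2 + s; those
  -- from 2t - 3 on are 3 + 2s, 4 + 2s, ....
  σ σ-middle σ-top : ℕ → ℕ
  σ = split (2 +_) σ-middle
  σ-middle 0 = 4 + s
  σ-middle 1 = 2 + s
  σ-middle 2 = 3 + s
  σ-middle (suc (suc (suc x))) = split (λ j → 5 + (j + s)) σ-top x
  σ-top 0 = 7 + (s + s)
  σ-top 1 = 5 + (s + s)
  σ-top 2 = 1
  σ-top 3 = 0
  σ-top _ = 6 + (s + s)

  π π-middle π-top : ℕ → ℕ
  π 0 = 6 + (s + s)
  π 1 = 5 + (s + s)
  π (suc (suc x)) = split id π-middle x
  π-middle 0 = 1 + s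
  π-middle 1 = 2 + s
  π-middle 2 = s
  π-middle (suc (suc (suc x))) = split (λ j → 3 + (j + s)) π-top x
  π-top 0 = 4 + (s + s)
  π-top 1 = 7 + (s + s)
  π-top _ = 3 + (s + s)

  σ-low : ∀ {x} → x < s → σ x ≡ 2 + x
  σ-low = split-< (2 +_) σ-middle

  σ-mid : ∀ k → σ (k + s) ≡ σ-middle k
  σ-mid = split-+ (2 +_) σ-middle

  σ-high : ∀ {j} → j < s → σ (3 + (j + s)) ≡ 5 + (j + s)
  σ-high {j} j<s = trans (σ-mid (3 + j)) (split-< (λ j → 5 + (j + s)) σ-top j<s)

  σ-topmost : ∀ k → σ (3 + (k + (s + s))) ≡ σ-top k
  σ-topmost k = trans (cong (λ x → σ (3 + x)) (sym (ℕ.+-assoc k s s)))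
    (trans (σ-mid (3 + (k + s))) (split-+ (λ j → 5 + (j + s)) σ-top k))

  π-mid : ∀ k → π (2 + (k + s)) ≡ π-middle k
  π-mid = split-+ id π-middle

  π-high : ∀ {j} → j < s → π (5 + (j + s)) ≡ 3 + (j + s)
  π-high {j} j<s = trans (π-mid (3 + j)) (split-< (λ j → 3 + (j + s)) π-top j<s)

  π-topmost : ∀ k → π (5 + (k + (s + s))) ≡ π-top k
  π-topmost k = trans (cong (λ x → π (5 + x)) (sym (ℕ.+-assoc k s s)))
    (trans (π-mid (3 + (k + s))) (split-+ (λ j → 3 + (j + s)) π-top k))

  -- One constructor for each case in which σ has its own formula.
  data Position : ℕ → Set where
    low  : ∀ {x} → x < s → Position x
    mid₀ : Position s
    mid₁ : Position (1 + s)
    mid₂ : Position (2 + s)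
    high : ∀ {j} → j < s → Position (3 + (j + s))
    top₀ : Position (3 + (s + s))
    top₁ : Position (4 + (s + s))
    top₂ : Position (5 + (s + s))
    top₃ : Position (6 + (s + s))
    top₄ : Position (7 + (s + s))

  position : ∀ {x} → x < 2 + q → Position x
  position {x} x< with below-or-above s x
  ... | inj₁ x<s = low x<s
  ... | inj₂ (0 , refl) = mid₀
  ... | inj₂ (1 , refl) = mid₁
  ... | inj₂ (2 , refl) = mid₂
  ... | inj₂ (suc (suc (suc j)) , refl) with below-or-above s j
  ... | inj₁ j<s = high j<s
  ... | inj₂ (0 , refl) = top₀
  ... | inj₂ (1 , refl) = top₁
  ... | inj₂ (2 , refl) = top₂
  ... | inj₂ (3 , refl) = top₃
  ... | inj₂ (4 , refl) = top₄
  ... | inj₂ (suc (suc (suc (suc (suc k)))) , refl) =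
    contradiction (subst (_< s + s) (ℕ.+-assoc k s s) (ℕ.+-cancelˡ-< 8 _ _ x<)) (ℕ.m+n≮n k (s + s))

  π∘σ : ∀ {u} → u < 2 + q → π (σ u) ≡ u
  π∘σ u< with position u<
  ... | low x<s  = trans (cong π (σ-low x<s)) (split-< id π-middle x<s)
  ... | mid₀     = trans (cong π (σ-mid 0)) (π-mid 2)
  ... | mid₁     = trans (cong π (σ-mid 1)) (π-mid 0)
  ... | mid₂     = trans (cong π (σ-mid 2)) (π-mid 1)
  ... | high j<s = trans (cong π (σ-high j<s)) (π-high j<s)
  ... | top₀     = trans (cong π (σ-topmost 0)) (π-topmost 2)
  ... | top₁     = trans (cong π (σ-topmost 1)) (π-topmost 0)
  ... | top₂     = cong π (σ-topmost 2)
  ... | top₃     = cong π (σ-topmost 3)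
  ... | top₄     = trans (cong π (σ-topmost 4)) (π-topmost 1)

  infix 4 _⇝_
  _⇝_ : Rel ℕ 0ℓ
  _⇝_ = Star (Successor (2 + q) σ)

  up : ∀ {u v} → σ u ≡ v → u < v → v < 2 + q → u ⇝ v
  up eq u<v v< = (ℕ.<-trans u<v v< , v< , ℕ.<⇒≢ u<v , eq) ◅ ε

  down : ∀ {u v} → σ u ≡ v → v < u → u < 2 + q → u ⇝ v
  down eq v<u u< = (u< , ℕ.<-trans v<u u< , ℕ.>⇒≢ v<u , eq) ◅ ε

  -- With numerals for m and k the sum `m + k` evaluates, so this compares terms such as 2 + n and 6
  -- + n.
  literal≤ : ∀ m k {n} → m + n ≤ (m + k) + n
  literal≤ m k {n} = ℕ.+-monoˡ-≤ n (ℕ.m≤m+n m k)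

  s≤s+s : s ≤ s + s
  s≤s+s = ℕ.m≤m+n s s

  low-step : ∀ {x} → x < s → x ⇝ 2 + x
  low-step x<s = up (σ-low x<s) (literal≤ 1 1)
    (ℕ.≤-trans (ℕ.+-monoʳ-≤ 2 (ℕ.≤-trans x<s s≤s+s)) (literal≤ 2 6))

  high-step : ∀ {j} → j < s → 3 + (j + s) ⇝ 5 + (j + s)
  high-step {j} j<s = up (σ-high j<s) (literal≤ 4 1)
    (ℕ.≤-trans (ℕ.+-monoʳ-≤ 5 (ℕ.+-monoˡ-≤ s j<s)) (literal≤ 5 3))

  mid₀-step : s ⇝ 4 + s
  mid₀-step = up (σ-mid 0) (literal≤ 1 3) (ℕ.≤-trans (ℕ.+-monoʳ-≤ 5 s≤s+s) (literal≤ 5 3))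

  mid₁-step : 1 + s ⇝ 2 + s
  mid₁-step = up (σ-mid 1) (literal≤ 2 0) (ℕ.≤-trans (ℕ.+-monoʳ-≤ 3 s≤s+s) (literal≤ 3 5))

  mid₂-step : 2 + s ⇝ 3 + s
  mid₂-step = up (σ-mid 2) (literal≤ 3 0) (ℕ.≤-trans (ℕ.+-monoʳ-≤ 4 s≤s+s) (literal≤ 4 4))

  top₀-step : 3 + (s + s) ⇝ 7 + (s + s)
  top₀-step = up (σ-topmost 0) (literal≤ 4 3) (literal≤ 8 0)

  top₁-step : 4 + (s + s) ⇝ 5 + (s + s)
  top₁-step = up (σ-topmost 1) (literal≤ 5 0) (literal≤ 6 2)

  top₂-step : 5 + (s + s) ⇝ 1
  top₂-step = down (σ-topmost 2) (s≤s (s≤s z≤n)) (literal≤ 6 2)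

  top₃-step : 6 + (s + s) ⇝ 0
  top₃-step = down (σ-topmost 3) (s≤s z≤n) (literal≤ 7 1)

  top₄-step : 7 + (s + s) ⇝ 6 + (s + s)
  top₄-step = down (σ-topmost 4) (literal≤ 7 0) (literal≤ 8 0)

  -- The path moves by 2 on the vertices 0 to 1 + s and on 3 + s to 4 + 2s. Either range breaks into
  -- two chains, which start at `F 0` and `F 1` and end at `F s` and `F (1 + s)`; the parity of s
  -- decides which start belongs to which end.
  module Strand (F : ℕ → ℕ) (step : ∀ {j} → j < s → F j ⇝ F (2 + j)) where

    climb : ∀ k j → twice k + j < 2 + s → F j ⇝ F (twice k + j)
    climb zero    j _             = ε
    climb (suc k) j (s≤s (s≤s h)) = climb k j (ℕ.m<n⇒m<1+n (ℕ.m<n⇒m<1+n h)) ◅◅ step h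

    climb-0 : ∀ k → twice k < 2 + s → F 0 ⇝ F (twice k)
    climb-0 k h = subst (λ x → F 0 ⇝ F x) (ℕ.+-identityʳ _)
      (climb k 0 (subst (_< 2 + s) (sym (ℕ.+-identityʳ _)) h))

    climb-1 : ∀ k → suc (twice k) < 2 + s → F 1 ⇝ F (suc (twice k))
    climb-1 k h = subst (λ x → F 1 ⇝ F x) (ℕ.+-comm (twice k) 1)
      (climb k 1 (subst (_< 2 + s) (ℕ.+-comm 1 (twice k)) h))

    from-bottom : ∀ {j} → j < 2 + s → F 0 ⇝ F j ⊎ F 1 ⇝ F j
    from-bottom {j} j< with parity j
    ... | k , inj₁ refl = inj₁ (climb-0 k j<)
    ... | k , inj₂ refl = inj₂ (climb-1 k j<)

    to-top : ∀ {j} → j < 2 + s → F j ⇝ F s ⊎ F j ⇝ F (1 + s)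
    to-top {j} (s≤s j≤) with offset j≤
    ... | w , eq with parity w
    ... | k , inj₁ refl = inj₂ (subst (λ x → F j ⇝ F x) (sym eq′) (climb k j (s≤s (ℕ.≤-reflexive (sym eq′)))))
      where
      eq′ : 1 + s ≡ twice k + j
      eq′ = trans eq (ℕ.+-comm j (twice k))
    ... | k , inj₂ refl = inj₁ (subst (λ x → F j ⇝ F x) (sym eq′)
                            (climb k j (ℕ.m<n⇒m<1+n (s≤s (ℕ.≤-reflexive (sym eq′))))))
      where
      eq′ : s ≡ twice k + j
      eq′ = ℕ.suc-injective (trans eq (ℕ.+-comm j (suc (twice k))))

    even-ends : ∀ k → s ≡ twice k → F 0 ⇝ F s × F 1 ⇝ F (1 + s)
    even-ends k eq =
        subst (λ x → F 0 ⇝ F x) (sym eq) (climb-0 k (subst (_< 2 + s) eq (literal≤ 1 1)))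
      , subst (λ x → F 1 ⇝ F (suc x)) (sym eq) (climb-1 k (subst (λ x → suc x < 2 + s) eq (ℕ.n<1+n (suc s))))

    odd-ends : ∀ k → s ≡ suc (twice k) → F 0 ⇝ F (1 + s) × F 1 ⇝ F s
    odd-ends k eq =
        subst (λ x → F 0 ⇝ F (suc x)) (sym eq) (climb-0 (suc k) (subst (λ x → suc x < 2 + s) eq (ℕ.n<1+n (suc s))))
      , subst (λ x → F 1 ⇝ F x) (sym eq) (climb-1 k (subst (_< 2 + s) eq (literal≤ 1 1)))

  module Low  = Strand id low-step
  module High = Strand (λ j → 3 + (j + s)) high-step

  -- The order in which the path passes the four strands depends on the
  -- parity of s.
  middle-links : s ⇝ suc q × 1 + s ⇝ suc q × 0 ⇝ 1
  middle-links with parity s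
  ... | k , inj₁ eq = mid₀⇝1 ◅◅ proj₂ lows ◅◅ mid₁⇝ω , mid₁⇝ω , proj₁ lows ◅◅ mid₀⇝1
    where
    lows = Low.even-ends k eq
    highs = High.even-ends k eq
    mid₁⇝ω = mid₁-step ◅◅ mid₂-step ◅◅ proj₁ highs ◅◅ top₀-step
    mid₀⇝1 = mid₀-step ◅◅ proj₂ highs ◅◅ top₁-step ◅◅ top₂-step
  ... | k , inj₂ eq = mid₀⇝ω , mid₁⇝1 ◅◅ proj₂ lows ◅◅ mid₀⇝ω , proj₁ lows ◅◅ mid₁⇝1
    where
    lows = Low.odd-ends k eq
    highs = High.odd-ends k eq
    mid₀⇝ω = mid₀-step ◅◅ proj₂ highs ◅◅ top₀-step
    mid₁⇝1 = mid₁-step ◅◅ mid₂-step ◅◅ proj₁ highs ◅◅ top₁-step ◅◅ top₂-step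

  low⇝ω : ∀ {x} → x < 2 + s → x ⇝ suc q
  low⇝ω x< with middle-links | Low.to-top x<
  ... | s⇝ω , _     , _ | inj₁ x⇝s   = x⇝s ◅◅ s⇝ω
  ... | _   , 1+s⇝ω , _ | inj₂ x⇝1+s = x⇝1+s ◅◅ 1+s⇝ω

  ω⇝low : ∀ {x} → x < 2 + s → suc q ⇝ x
  ω⇝low x< with middle-links | Low.from-bottom x<
  ... | _           | inj₁ 0⇝x = top₄-step ◅◅ top₃-step ◅◅ 0⇝x
  ... | _ , _ , 0⇝1 | inj₂ 1⇝x = top₄-step ◅◅ top₃-step ◅◅ 0⇝1 ◅◅ 1⇝x

  top₂⇝ω : 5 + (s + s) ⇝ suc q
  top₂⇝ω = top₂-step ◅◅ low⇝ω (s≤s (s≤s z≤n))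

  high⇝ω : ∀ {j} → j < 2 + s → 3 + (j + s) ⇝ suc q
  high⇝ω j< with High.to-top j<
  ... | inj₁ j⇝top₀ = j⇝top₀ ◅◅ top₀-step
  ... | inj₂ j⇝top₁ = j⇝top₁ ◅◅ top₁-step ◅◅ top₂⇝ω

  ω⇝mid₂ : suc q ⇝ 2 + s
  ω⇝mid₂ = ω⇝low (literal≤ 2 0) ◅◅ mid₁-step

  ω⇝high : ∀ {j} → j < 2 + s → suc q ⇝ 3 + (j + s)
  ω⇝high j< with High.from-bottom j<
  ... | inj₁ ⇝j = ω⇝mid₂ ◅◅ mid₂-step ◅◅ ⇝j
  ... | inj₂ ⇝j = ω⇝low (literal≤ 1 1) ◅◅ mid₀-step ◅◅ ⇝j

  through-ω : ∀ {x} → x < 2 + q → suc q ⇝ x × x ⇝ suc q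
  through-ω x< with position x<
  ... | low x<s  = let x<2+s = ℕ.≤-trans x<s (literal≤ 0 2) in ω⇝low x<2+s , low⇝ω x<2+s
  ... | mid₀     = ω⇝low (literal≤ 1 1) , low⇝ω (literal≤ 1 1)
  ... | mid₁     = ω⇝low (literal≤ 2 0) , low⇝ω (literal≤ 2 0)
  ... | mid₂     = ω⇝mid₂ , mid₂-step ◅◅ high⇝ω (s≤s z≤n)
  ... | high j<s = let j<2+s = ℕ.≤-trans j<s (literal≤ 0 2) in ω⇝high j<2+s , high⇝ω j<2+s
  ... | top₀     = ω⇝high (literal≤ 1 1) , top₀-step
  ... | top₁     = ω⇝high (literal≤ 2 0) , high⇝ω (literal≤ 2 0)
  ... | top₂     = ω⇝high (literal≤ 2 0) ◅◅ top₁-step , top₂⇝ω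
  ... | top₃     = top₄-step , top₃-step ◅◅ low⇝ω (s≤s z≤n)
  ... | top₄     = ε , ε

  cyclic : ∀ {u v} → u < 2 + q → v < 2 + q → u ⇝ v
  cyclic u< v< = proj₂ (through-ω u<) ◅◅ proj₁ (through-ω v<)

  open Walecki t

  <t+t : ∀ {x} → x < q → x < t + t
  <t+t {x} = subst (x <_) (sym t+t≡q)

  Carried : ℕ → Set
  Carried i = ∃ λ u → u < suc q × σ u < suc q × walecki t u (σ u) ≡ i

  carried : ∀ {i u v} → u < suc q → v < suc q → σ u ≡ v → walecki t u v ≡ i → Carried i
  carried {u = u} u< v< refl eq = u , u< , v< , eq

  carried-up : ∀ {i u v} → u < v → v < q → σ u ≡ v → walecki t u v ≡ i → Carried i
  carried-up u<v v<q = carried (ℕ.m<n⇒m<1+n (ℕ.<-trans u<v v<q)) (ℕ.m<n⇒m<1+n v<q)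

  -- An upward step of 2 has an even sum, so its colour is the antipode of the skipped vertex. The
  -- low strands give the colours 4 + s to 3 + 2s, the high ones 1 to s.
  carried-low : ∀ {x} → x < s → Carried (4 + (x + s))
  carried-low {x} x<s = carried-up (literal≤ 1 1) 2+x<q (σ-low x<s)
      (trans (up-even (1 + x) (literal≤ 1 1) (<t+t 2+x<q) (sum x))
        (trans (antipode-< (ℕ.≤-trans (s≤s x<s) (literal≤ 1 2))) (cong suc (assoc x s))))
    where
    2+x<q : 2 + x < q
    2+x<q = ℕ.≤-trans (ℕ.+-monoʳ-≤ 2 (ℕ.≤-trans x<s s≤s+s)) (literal≤ 2 4)
    sum : ∀ x → x + (2 + x) ≡ (1 + x) + (1 + x)
    sum = solve-∀
    assoc : ∀ x s → x + (3 + s) ≡ 3 + (x + s)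
    assoc = solve-∀

  carried-high : ∀ {j} → j < s → Carried (1 + j)
  carried-high {j} j<s = carried-up (literal≤ 4 1) v<q (σ-high j<s)
      (trans (up-even ((1 + j) + t) (literal≤ 4 1) (<t+t v<q) (sum j s)) (antipode-+ t (1 + j)))
    where
    v<q : 5 + (j + s) < q
    v<q = ℕ.≤-trans (ℕ.+-monoʳ-≤ 5 (ℕ.+-monoˡ-≤ s j<s)) (literal≤ 5 1)
    sum : ∀ j s → (3 + (j + s)) + (5 + (j + s)) ≡ ((1 + j) + (3 + s)) + ((1 + j) + (3 + s))
    sum = solve-∀

  -- Colour 0 lies on the arc from ∞ to 0. Besides the colours of the strands there remain 1 + s, 2
  -- + s, t, 2t - 2 and 2t - 1, carried by the steps out of 1 + s, 2 + s, 2t - 1, 2t - 2 and s, in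
  -- this order.
  rainbow : ∀ {i} → i < q → Carried i
  rainbow {zero} _ = carried (literal≤ 7 0) (s≤s z≤n) (σ-topmost 3)
    (trans (cong (λ x → walecki t x 0) (sym t+t≡q)) (walecki-∞ˡ 0))
  rainbow {suc i} i< with below-or-above s i
  ... | inj₁ i<s = carried-high i<s
  ... | inj₂ (0 , refl) = carried-up (literal≤ 2 0) v<q (σ-mid 1)
      (up-odd (1 + s) (literal≤ 2 0) (<t+t v<q) (ℕ.+-suc (1 + s) (1 + s)))
    where v<q = ℕ.≤-trans (ℕ.+-monoʳ-≤ 3 s≤s+s) (literal≤ 3 3)
  ... | inj₂ (1 , refl) = carried-up (literal≤ 3 0) v<q (σ-mid 2)
      (up-odd (2 + s) (literal≤ 3 0) (<t+t v<q) (ℕ.+-suc (2 + s) (2 + s)))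
    where v<q = ℕ.≤-trans (ℕ.+-monoʳ-≤ 4 s≤s+s) (literal≤ 4 2)
  ... | inj₂ (2 , refl) = carried (literal≤ 6 1) (s≤s (s≤s z≤n)) (σ-topmost 2)
      (down-even t (s≤s (s≤s z≤n)) (<t+t (literal≤ 6 0)) (sum s))
    where
    sum : ∀ s → (5 + (s + s)) + 1 ≡ (3 + s) + (3 + s)
    sum = solve-∀
  ... | inj₂ (suc (suc (suc x)) , refl) with below-or-above s x
  ... | inj₁ x<s = carried-low x<s
  ... | inj₂ (0 , refl) = carried-up (literal≤ 5 0) (literal≤ 6 0) (σ-topmost 1)
      (up-odd (4 + (s + s)) (literal≤ 5 0) (<t+t (literal≤ 6 0)) (ℕ.+-suc (4 + (s + s)) (4 + (s + s))))
  ... | inj₂ (1 , refl) = carried-up (literal≤ 1 3) v<q (σ-mid 0)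
      (trans (up-even (2 + s) (literal≤ 1 3) (<t+t v<q) (sum s))
        (trans (antipode-< (literal≤ 3 0)) (cong (2 +_) (assoc s))))
    where
    v<q = ℕ.≤-trans (ℕ.+-monoʳ-≤ 5 s≤s+s) (literal≤ 5 1)
    sum : ∀ s → s + (4 + s) ≡ (2 + s) + (2 + s)
    sum = solve-∀
    assoc : ∀ s → s + (3 + s) ≡ 3 + (s + s)
    assoc = solve-∀
  ... | inj₂ (suc (suc k) , refl) =
    contradiction (subst (_< s + s) (ℕ.+-assoc k s s) (ℕ.+-cancelˡ-< 6 _ _ i<)) (ℕ.m+n≮n k (s + s))

  colouring : ℕ → ℕ → ℕ
  colouring = insertVertex q (walecki t) σ π

  colouring-strong : StrongColouring (suc q) colouring
  colouring-strong = Insert.insertVertex-strong {c = walecki t} {σ} {π}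
    (subst (λ r → StrongColouring r (walecki t)) t+t≡q (walecki-strong t)) π∘σ cyclic rainbow

-- Subgraphs given by decidable relations

module _ {n : ℕ} (V : Subset n) {R : Rel (Fin n) 0ℓ} (R? : Decidable R) where

  fromRelation : Subgraph n
  fromRelation = subgraph V (Vec.tabulate λ u → Vec.tabulate λ v → does (R? u v))

  private
    lookup-heads : ∀ u v → Vec.lookup (Vec.lookup (heads fromRelation) u) v ≡ does (R? u v)
    lookup-heads u v = trans (cong (λ row → Vec.lookup row v) (Vec.lookup∘tabulate _ u)) (Vec.lookup∘tabulate _ v)

  arc⁺ : ∀ {u v} → R u v → ArcOf fromRelation u v
  arc⁺ {u} {v} r = Vec.lookup⇒[]= v _ (trans (lookup-heads u v) (dec-true (R? u v) r))

  arc⁻ : ∀ u v → ArcOf fromRelation u v → R u v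
  arc⁻ u v a with R? u v | trans (sym (lookup-heads u v)) (Vec.[]=⇒lookup a)
  ... | yes r | _ = r

-- Arcs at a vertex of S, and packings from indexed families

Complete : ∀ {n} → Digraph n → Set
Complete D = ∀ {u v} → u ≢ v → Arc D u v

other-member : ∀ {n} {S : Subset n} {u} → 2 ≤ ∣ S ∣ → ∃ λ w → w Subset.∈ S × w ≢ u
other-member {S = S} {u} 2≤∣S∣ with Fin.any? (λ w → (w Subset.∈? S) ×-dec ¬? (w Fin.≟ u))
... | yes found = found
... | no  none  = contradiction 2≤∣S∣ (ℕ.<⇒≱ (s≤s (subst (∣ S ∣ ≤_) (Subset.∣⁅x⁆∣≡1 u) (Subset.p⊆q⇒∣p∣≤∣q∣ S⊆⁅u⁆))))
  where
  S⊆⁅u⁆ : S Subset.⊆ ⁅ u ⁆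
  S⊆⁅u⁆ {w} w∈S with w Fin.≟ u
  ... | yes refl = Subset.x∈⁅x⁆ u
  ... | no  w≢u  = contradiction (w , w∈S , w≢u) none

nonempty : ∀ {n} {S : Subset n} → 1 ≤ ∣ S ∣ → ∃ (Subset._∈ S)
nonempty {S = inside  ∷ S} _ = zero , Vec.here
nonempty {S = outside ∷ S} h with nonempty h
... | u , u∈S = suc u , Vec.there u∈S

first-step : ∀ {A : Set} {R : Rel A 0ℓ} {u v} → u ≢ v → Star R u v → ∃ (R u)
first-step u≢v ε       = contradiction refl u≢v
first-step _   (r ◅ _) = _ , r

out-arc : ∀ {n} {D : Digraph n} {S u H} → 2 ≤ ∣ S ∣ → u Subset.∈ S →
  IsStrongSubgraphContaining D S H → ∃ (ArcOf H u)
out-arc {u = u} 2≤∣S∣ u∈S (_ , strong , S⊆) with other-member {u = u} 2≤∣S∣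
... | w , w∈S , w≢u = first-step (w≢u ∘ sym) (strong u w (S⊆ u∈S) (S⊆ w∈S))

-- Repetition is impossible: `H i` has an arc out of a vertex of S, because S has a second vertex,
-- and an equal `H j` would share it.
family-packing : ∀ {n q} {D : Digraph n} {S} (H : Fin q → Subgraph n) → 2 ≤ ∣ S ∣ →
  (∀ i → IsStrongSubgraphContaining D S (H i)) →
  (∀ {i j} → i ≢ j → ArcDisjoint (H i) (H j)) →
  IsPacking D S (List.tabulate H)
family-packing {D = D} {S} H 2≤∣S∣ strong disjoint =
  Unique.tabulate⁺ injective , All.tabulate⁺ strong , AllPairs.tabulate⁺ disjoint
  where
  injective : ∀ {i j} → H i ≡ H j → i ≡ j
  injective {i} {j} eq with i Fin.≟ j
  ... | yes i≡j = i≡j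
  ... | no  i≢j with nonempty {S = S} (ℕ.<⇒≤ 2≤∣S∣)
  ... | u , u∈S with out-arc {D = D} {H = H i} 2≤∣S∣ u∈S (strong i)
  ... | v , a = contradiction (a , subst (λ K → ArcOf K u v) eq a) (disjoint i≢j u v)

-- Packings of complete digraphs

ColourArc : ∀ {n} → (ℕ → ℕ → ℕ) → ℕ → Rel (Fin n) 0ℓ
ColourArc c i u v = u ≢ v × c (toℕ u) (toℕ v) ≡ i

colourArc? : ∀ {n} c i → Decidable (ColourArc {n} c i)
colourArc? c i u v = ¬? (u Fin.≟ v) ×-dec (c (toℕ u) (toℕ v) ≟ i)

-- The ends come with equations for their values, so that the induction can pass through `fromℕ<` of
-- each intermediate vertex.
class⇒colourArc : ∀ {n c i x y} → Star (Class n c i) x y →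
  ∀ (u v : Fin n) → toℕ u ≡ x → toℕ v ≡ y → Star (ColourArc c i) u v
class⇒colourArc ε u v refl eq with Fin.toℕ-injective eq
... | refl = ε
class⇒colourArc {c = c} ((_ , y< , x≢y , col) ◅ walk) u v refl eq =
  ((λ u≡w → x≢y (trans (cong toℕ u≡w) toℕw)) , trans (cong (c (toℕ u)) toℕw) col) ◅
  class⇒colourArc walk (fromℕ< y<) v toℕw eq
  where toℕw = Fin.toℕ-fromℕ< y<

colour-connected : ∀ {q c} → StrongColouring q c → (i : Fin q) → ∀ u v → Star (ColourArc {suc q} c (toℕ i)) u v
colour-connected strong i u v =
  class⇒colourArc (strong (Fin.toℕ<n i) (Fin.toℕ<n u) (Fin.toℕ<n v)) u v refl refl

colouring-packing : ∀ {q c} → StrongColouring q c → {D : Digraph (suc q)} → Complete D →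
  ∀ {S} → 2 ≤ ∣ S ∣ → ∃ λ Hs → IsPacking D S Hs × length Hs ≡ q
colouring-packing {q} {c} strong {D} complete {S} 2≤∣S∣ =
  List.tabulate H , family-packing {D = D} H 2≤∣S∣ H-strong H-disjoint , length-tabulate H
  where
  H : Fin q → Subgraph (suc q)
  H i = fromRelation ⊤ (colourArc? c (toℕ i))
  H-strong : ∀ i → IsStrongSubgraphContaining D S (H i)
  H-strong i =
      (λ u v a → Subset.∈⊤ , Subset.∈⊤ , complete (proj₁ (arc⁻ ⊤ (colourArc? c (toℕ i)) u v a)))
    , (λ u v _ _ → Star.map (arc⁺ ⊤ (colourArc? c (toℕ i))) (colour-connected strong i u v))
    , Subset.⊆⊤
  H-disjoint : ∀ {i j} → i ≢ j → ArcDisjoint (H i) (H j)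
  H-disjoint {i} {j} i≢j u v (a , b) = i≢j (Fin.toℕ-injective (trans
    (sym (proj₂ (arc⁻ ⊤ (colourArc? c (toℕ i)) u v a))) (proj₂ (arc⁻ ⊤ (colourArc? c (toℕ j)) u v b))))

StarArc : ∀ {n} → Fin n → Rel (Fin n) 0ℓ
StarArc v u w = (u ≡ v × w ≢ v) ⊎ (u ≢ v × w ≡ v)

starArc? : ∀ {n} (v : Fin n) → Decidable (StarArc v)
starArc? v u w = ((u Fin.≟ v) ×-dec ¬? (w Fin.≟ v)) ⊎-dec (¬? (u Fin.≟ v) ×-dec (w Fin.≟ v))

starArc-irrefl : ∀ {n} {v u w : Fin n} → StarArc v u w → u ≢ w
starArc-irrefl (inj₁ (refl , w≢v)) refl = w≢v refl
starArc-irrefl (inj₂ (u≢v , refl)) refl = u≢v refl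

star-connected : ∀ {n} (v u w : Fin n) → Star (StarArc v) u w
star-connected v u w = to u ◅◅ from w
  where
  to : ∀ u → Star (StarArc v) u v
  to u with u Fin.≟ v
  ... | yes refl = ε
  ... | no  u≢v  = inj₂ (u≢v , refl) ◅ ε
  from : ∀ w → Star (StarArc v) v w
  from w with w Fin.≟ v
  ... | yes refl = ε
  ... | no  w≢v  = inj₁ (refl , w≢v) ◅ ε

PunchedArc : ∀ {n} → Fin (suc n) → Rel (Fin n) 0ℓ → Rel (Fin (suc n)) 0ℓ
PunchedArc v R u w = ∃₂ λ a b → punchIn v a ≡ u × punchIn v b ≡ w × R a b

punchedArc? : ∀ {n} v {R : Rel (Fin n) 0ℓ} → Decidable R → Decidable (PunchedArc v R)
punchedArc? v R? u w = Fin.any? λ a → Fin.any? λ b →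
  (punchIn v a Fin.≟ u) ×-dec ((punchIn v b Fin.≟ w) ×-dec R? a b)

-- The colour classes avoid v, which is allowed since v lies outside S. The star of all arcs at v,
-- in both directions, is disjoint from them and is the last subgraph.
star-packing : ∀ {q c} → StrongColouring q c → {D : Digraph (suc (suc q))} → Complete D →
  ∀ {S v} → 2 ≤ ∣ S ∣ → v Subset.∉ S → ∃ λ Hs → IsPacking D S Hs × length Hs ≡ suc q
star-packing {q} {c} strong {D} complete {S} {v} 2≤∣S∣ v∉S =
  List.tabulate H , family-packing {D = D} H 2≤∣S∣ H-strong H-disjoint , length-tabulate H
  where
  V = ∁ ⁅ v ⁆

  ≢⇒∈V : ∀ {u} → u ≢ v → u Subset.∈ V
  ≢⇒∈V u≢v = Subset.x∉p⇒x∈∁p (Subset.x≢y⇒x∉⁅y⁆ u≢v)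

  ∈V⇒≢ : ∀ {u} → u Subset.∈ V → u ≢ v
  ∈V⇒≢ u∈V = Subset.x∉⁅y⁆⇒x≢y (Subset.x∈∁p⇒x∉p u∈V)

  class? : ∀ i → Decidable (PunchedArc v (ColourArc c i))
  class? i = punchedArc? v (colourArc? c i)

  H : Fin (suc q) → Subgraph (suc (suc q))
  H zero    = fromRelation ⊤ (starArc? v)
  H (suc i) = fromRelation V (class? (toℕ i))

  H-strong : ∀ i → IsStrongSubgraphContaining D S (H i)
  H-strong zero =
      (λ u w a → Subset.∈⊤ , Subset.∈⊤ , complete (starArc-irrefl (arc⁻ ⊤ (starArc? v) u w a)))
    , (λ u w _ _ → Star.map (arc⁺ ⊤ (starArc? v)) (star-connected v u w))
    , Subset.⊆⊤
  H-strong (suc i) = sub , conn , λ u∈S → ≢⇒∈V λ { refl → v∉S u∈S }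
    where
    sub : IsSubgraph D (H (suc i))
    sub u w a with arc⁻ V (class? (toℕ i)) u w a
    ... | x , y , refl , refl , x≢y , _ =
      ≢⇒∈V (Fin.punchInᵢ≢i v x) , ≢⇒∈V (Fin.punchInᵢ≢i v y) , complete (x≢y ∘ Fin.punchIn-injective v x y)
    conn : StrongSubgraph (H (suc i))
    conn u w u∈ w∈ = subst₂ (Star _) (Fin.punchIn-punchOut v≢u) (Fin.punchIn-punchOut v≢w)
      (Star.gmap (punchIn v) (λ r → arc⁺ V (class? (toℕ i)) (_ , _ , refl , refl , r))
        (colour-connected strong i (punchOut v≢u) (punchOut v≢w)))
      where
      v≢u = ∈V⇒≢ u∈ ∘ sym
      v≢w = ∈V⇒≢ w∈ ∘ sym

  star-disjoint : ∀ i → ArcDisjoint (H zero) (H (suc i))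
  star-disjoint i u w (a , b) with arc⁻ ⊤ (starArc? v) u w a | arc⁻ V (class? (toℕ i)) u w b
  ... | inj₁ (x≡v , _) | x , y , refl , refl , _ = Fin.punchInᵢ≢i v x x≡v
  ... | inj₂ (_ , y≡v) | x , y , refl , refl , _ = Fin.punchInᵢ≢i v y y≡v

  H-disjoint : ∀ {i j} → i ≢ j → ArcDisjoint (H i) (H j)
  H-disjoint {zero}  {zero}  i≢j = contradiction refl i≢j
  H-disjoint {zero}  {suc j} _   = star-disjoint j
  H-disjoint {suc i} {zero}  _   = λ u w (a , b) → star-disjoint i u w (b , a)
  H-disjoint {suc i} {suc j} i≢j u w (a , b)
    with arc⁻ V (class? (toℕ i)) u w a | arc⁻ V (class? (toℕ j)) u w b
  ... | x , y , refl , refl , _ , eq | x′ , y′ , p , p′ , _ , eq′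
    with Fin.punchIn-injective v x′ x p | Fin.punchIn-injective v y′ y p′
  ... | refl | refl = i≢j (cong suc (Fin.toℕ-injective (trans (sym eq) eq′)))

-- Even q is Walecki's case, q = 1 is a single 2-cycle, and an odd q ≥ 7 has the form 7 + 2s, where
-- a vertex is inserted. The values 3 and 5 are the excluded orders 4 and 6.
strongColouring : ∀ q → suc q ≢ 4 → suc q ≢ 6 → ∃ (StrongColouring q)
strongColouring q q≢3 q≢5 with parity q
... | t , inj₁ refl = walecki t , subst (λ r → StrongColouring r (walecki t)) (sym (twice≡+ t)) (walecki-strong t)
... | 0 , inj₂ refl = (λ _ _ → 0) , λ
  { (s≤s z≤n) (s≤s z≤n)       (s≤s z≤n)       → ε
  ; (s≤s z≤n) (s≤s z≤n)       (s≤s (s≤s z≤n)) → (s≤s z≤n , s≤s (s≤s z≤n) , (λ ()) , refl) ◅ ε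
  ; (s≤s z≤n) (s≤s (s≤s z≤n)) (s≤s z≤n)       → (s≤s (s≤s z≤n) , s≤s z≤n , (λ ()) , refl) ◅ ε
  ; (s≤s z≤n) (s≤s (s≤s z≤n)) (s≤s (s≤s z≤n)) → ε
  }
... | 1 , inj₂ refl = contradiction refl q≢3
... | 2 , inj₂ refl = contradiction refl q≢5
... | suc (suc (suc s)) , inj₂ refl = colouring ,
  subst (λ r → StrongColouring (7 + r) colouring) (sym (twice≡+ s)) colouring-strong
  where open RainbowPath s

non-member : ∀ {n} {S : Subset n} → ∣ S ∣ < n → ∃ (Subset._∉ S)
non-member {n} {S} ∣S∣<n = Fin.¬∀⟶∃¬ n (Subset._∈ S) (Subset._∈? S) λ all∈S →
  ℕ.<⇒≱ ∣S∣<n (subst (_≤ ∣ S ∣) (Subset.∣⊤∣≡n n) (Subset.p⊆q⇒∣p∣≤∣q∣ {p = ⊤} {S} λ {u} _ → all∈S u))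

complete-packing : ∀ {q} {D : Digraph (suc q)} {S} → Complete D → 2 ≤ ∣ S ∣ →
  (suc q ≢ 4 × suc q ≢ 6) ⊎ ∣ S ∣ < suc q → ∃ λ Hs → IsPacking D S Hs × length Hs ≡ q
complete-packing {D = D} complete 2≤∣S∣ (inj₁ (≢4 , ≢6)) =
  colouring-packing (proj₂ (strongColouring _ ≢4 ≢6)) {D} complete 2≤∣S∣
complete-packing {q} {D} complete 2≤∣S∣ (inj₂ ∣S∣<n) with suc q ≟ 4 | suc q ≟ 6
... | yes refl | _        = star-packing (walecki-strong 1) {D} complete 2≤∣S∣ (proj₂ (non-member ∣S∣<n))
... | no _     | yes refl = star-packing (walecki-strong 2) {D} complete 2≤∣S∣ (proj₂ (non-member ∣S∣<n))
... | no ≢4    | no ≢6    = colouring-packing (proj₂ (strongColouring _ ≢4 ≢6)) {D} complete 2≤∣S∣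

-- Heads of the arcs of a packing at a vertex

AllPairs-lookup : ∀ {A : Set} {R : Rel A 0ℓ} → (∀ {x y} → R x y → R y x) → ∀ {xs} → AllPairs R xs →
  ∀ {i j} → i ≢ j → R (List.lookup xs i) (List.lookup xs j)
AllPairs-lookup R-sym (_ ∷ _)  {zero}  {zero}  i≢j = contradiction refl i≢j
AllPairs-lookup R-sym (r ∷ _)  {zero}  {suc j} _   = All.lookup r (∈-lookup j)
AllPairs-lookup R-sym (r ∷ _)  {suc i} {zero}  _   = R-sym (All.lookup r (∈-lookup i))
AllPairs-lookup R-sym (_ ∷ rs) {suc i} {suc j} i≢j = AllPairs-lookup R-sym rs (i≢j ∘ cong suc)

-- If v were missed, punching it out would leave an injection into a smaller set.
injective⇒surjective : ∀ {m n} {f : Fin m → Fin n} → Injective _≡_ _≡_ f → n ≤ m → ∀ v → ∃ λ i → f i ≡ v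
injective⇒surjective {m} {suc n} {f} inj n<m v with Fin.any? (λ i → f i Fin.≟ v)
... | yes found = found
... | no  none  = contradiction (Fin.injective⇒≤ {f = g} λ eq → inj (Fin.punchOut-injective (v≢ _) (v≢ _) eq)) (ℕ.<⇒≱ n<m)
  where
  v≢ : ∀ i → v ≢ f i
  v≢ i v≡fi = none (i , sym v≡fi)
  g : Fin m → Fin n
  g i = punchOut (v≢ i)

module Heads {n : ℕ} {D : Digraph n} {S : Subset n} {Hs : List (Subgraph n)}
  (packing : IsPacking D S Hs) (2≤∣S∣ : 2 ≤ ∣ S ∣) where

  q : ℕ
  q = length Hs

  strong-at : ∀ h → IsStrongSubgraphContaining D S (List.lookup Hs h)
  strong-at h = All.lookup (proj₁ (proj₂ packing)) (∈-lookup h)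

  disjoint-at : ∀ {h h′} → h ≢ h′ → ArcDisjoint (List.lookup Hs h) (List.lookup Hs h′)
  disjoint-at = AllPairs-lookup (λ d u v (a , b) → d u v (b , a)) (proj₂ (proj₂ packing))

  module _ {u} (u∈S : u Subset.∈ S) where

    out-arc-at : ∀ h → ∃ (ArcOf (List.lookup Hs h) u)
    out-arc-at h = out-arc {D = D} {H = List.lookup Hs h} 2≤∣S∣ u∈S (strong-at h)

    head : Fin q → Fin n
    head h = proj₁ (out-arc-at h)

    head-arcOf : ∀ h → ArcOf (List.lookup Hs h) u (head h)
    head-arcOf h = proj₂ (out-arc-at h)

    head-arc : ∀ h → Arc D u (head h)
    head-arc h = proj₂ (proj₂ (proj₁ (strong-at h) u (head h) (head-arcOf h)))

    head≢ : ∀ h → head h ≢ u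
    head≢ h eq = loopless D u (subst (Arc D u) eq (head-arc h))

    head-injective : Injective _≡_ _≡_ head
    head-injective {h} {h′} eq with h Fin.≟ h′
    ... | yes h≡h′ = h≡h′
    ... | no  h≢h′ = contradiction
      (head-arcOf h , subst (ArcOf (List.lookup Hs h′) u) (sym eq) (head-arcOf h′))
      (disjoint-at h≢h′ u (head h))

    tail∷heads : Fin (suc q) → Fin n
    tail∷heads zero    = u
    tail∷heads (suc h) = head h

    tail∷heads-injective : Injective _≡_ _≡_ tail∷heads
    tail∷heads-injective {zero}  {zero}   _  = refl
    tail∷heads-injective {zero}  {suc h′} eq = contradiction (sym eq) (head≢ h′)
    tail∷heads-injective {suc h} {zero}   eq = contradiction eq (head≢ h)
    tail∷heads-injective {suc h} {suc h′} eq = cong suc (head-injective eq)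

    -- The vertex u and the heads chosen by the members are 1 + q different vertices.
    size-bound : suc q ≤ n
    size-bound = Fin.injective⇒≤ tail∷heads-injective

    head-surjective : n ≤ suc q → ∀ {v} → v ≢ u → ∃ λ h → head h ≡ v
    head-surjective n≤ {v} v≢u with injective⇒surjective tail∷heads-injective n≤ v
    ... | zero  , eq = contradiction (sym eq) v≢u
    ... | suc h , eq = h , eq

    -- Every vertex other than u is already the chosen head of some member. A second arc out of u in
    -- member h would therefore coincide with the chosen arc of another member.
    only-head : n ≤ suc q → ∀ h {v} → ArcOf (List.lookup Hs h) u v → head h ≡ v
    only-head n≤ h {v} a
      with head-surjective n≤ {v} (λ { refl → loopless D u (proj₂ (proj₂ (proj₁ (strong-at h) u v a))) })
    ... | h′ , eq with h Fin.≟ h′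
    ... | yes refl = eq
    ... | no  h≢h′ = contradiction (a , subst (ArcOf (List.lookup Hs h′) u) eq (head-arcOf h′)) (disjoint-at h≢h′ u v)

-- Hamiltonian decompositions of order 4 and 6

module _ {A : Set} {_#_ : Rel A 0ℓ} (_#?_ : Decidable _#_) where

  -- Backtracking search for pairwise related entries, one from each list: a choice from the first
  -- list prunes the others.
  exhausted : ∀ {k} → Vec (List A) k → Bool
  -- Once no list is left, a full selection has been found.
  exhausted []       = false
  exhausted (l ∷ ls) = all (λ x → exhausted (Vec.map (filter (x #?_)) ls)) l

  exhausted-sound : ∀ {k} (ls : Vec (List A) k) → exhausted ls ≡ true →
    (xs : Fin k → A) → (∀ i → xs i ∈ Vec.lookup ls i) → ¬ (∀ {i j} → i ≢ j → xs i # xs j)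
  exhausted-sound (l ∷ ls) ex xs xs∈ xs# =
    exhausted-sound (Vec.map (filter (xs zero #?_)) ls)
      (Equivalence.to T-≡ (All.lookup (All.all⁺ _ l (Equivalence.from T-≡ ex)) (xs∈ zero))) (xs ∘ suc)
      (λ i → subst (xs (suc i) ∈_) (sym (Vec.lookup-map i _ ls))
        (∈-filter⁺ (xs zero #?_) (xs∈ (suc i)) (xs# λ ())))
      (λ i≢j → xs# (i≢j ∘ Fin.suc-injective))

Table : ℕ → Set
Table n = Vec (Fin n) n

choices : ∀ {A : Set} {n} → (Fin n → List A) → List (Vec A n)
choices {n = zero}  r = [] ∷ []
choices {n = suc n} r = cartesianProductWith _∷_ (r zero) (choices (r ∘ suc))

∈-choices : ∀ {A : Set} {n} {r : Fin n → List A} {f : Fin n → A} → (∀ i → f i ∈ r i) → Vec.tabulate f ∈ choices r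
∈-choices {n = zero}  _ = here refl
∈-choices {n = suc n} f∈ = ∈-cartesianProductWith⁺ _∷_ (f∈ zero) (∈-choices (f∈ ∘ suc))

orbit : ∀ {n} → Table n → ℕ → Fin n → List (Fin n)
orbit f zero    x = []
orbit f (suc k) x = x ∷ orbit f k (Vec.lookup f x)

-- The orbit is in fact always closed; having this as a hypothesis that the
-- search evaluates saves a pigeonhole argument.
Connected : ∀ {m} → Table (suc m) → Set
Connected {m} f = (∃ λ x → Vec.lookup f x ≡ zero) × (All (λ x → Vec.lookup f x ∈ O) O → ∀ v → v ∈ O)
  where O = orbit f (suc m) zero

connected? : ∀ {m} (f : Table (suc m)) → Dec (Connected f)
connected? {m} f = Fin.any? (λ x → Vec.lookup f x Fin.≟ zero) ×-dec (All.all? (λ x → Vec.lookup f x ∈? O) O →-dec Fin.all? (_∈? O))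
  where
  O = orbit f (suc m) zero
  open DecMembership Fin._≟_ using (_∈?_)

Disjoint : ∀ {n} → Rel (Table n) 0ℓ
Disjoint f g = ∀ u → Vec.lookup f u ≢ Vec.lookup g u

disjoint? : ∀ {n} → Decidable (Disjoint {n})
disjoint? f g = Fin.all? λ u → ¬? (Vec.lookup f u Fin.≟ Vec.lookup g u)

-- The m cycles of a decomposition leave vertex 0 towards the m other vertices, one each, so cycle v
-- may be taken to go from 0 to v + 1. This normalisation keeps the search small.
row : ∀ {m} → Fin m → Fin (suc m) → List (Fin (suc m))
row v zero    = suc v ∷ []
row v (suc u) = filter (λ w → ¬? (w Fin.≟ suc u)) (allFin _)

cycles : ∀ {m} → Fin m → List (Table (suc m))
cycles v = filter connected? (choices (row v))

-- A record, so that comparing types does not run the search.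
record NoDecomposition (m : ℕ) : Set where
  constructor by-search
  field search : exhausted disjoint? (Vec.tabulate (cycles {m})) ≡ true

no-decomposition₄ : NoDecomposition 3
no-decomposition₄ = by-search refl

no-decomposition₆ : NoDecomposition 5
no-decomposition₆ = by-search refl

last-step : ∀ {A : Set} {R : Rel A 0ℓ} {u v} → u ≢ v → Star R u v → ∃ λ x → R x v
last-step u≢v walk = first-step (u≢v ∘ sym) (Star.reverse id walk)

preserved : ∀ {A : Set} {R : Rel A 0ℓ} (P : A → Set) → (∀ {x y} → P x → R x y → P y) →
  ∀ {u v} → Star R u v → P u → P v
preserved P step ε          p = p
preserved P step (r ◅ walk) p = preserved P step walk (step p r)

record HamiltonianDecomposition (m : ℕ) : Set where
  field
    next          : Fin m → Fin (suc m) → Fin (suc m)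
    next-zero     : ∀ v → next v zero ≡ suc v
    next≢         : ∀ v u → next v u ≢ u
    next-disjoint : ∀ {v w} → v ≢ w → ∀ u → next v u ≢ next w u
    walk          : ∀ v x y → Star (λ x y → next v x ≡ y) x y

-- By `only-head` a member has one arc out of each vertex, so its walks follow the chosen heads. The
-- member with the arc from 0 to v + 1 gets number v.
spanning-packing⇒decomposition : ∀ {m} → 1 ≤ m → {D : Digraph (suc m)} → ∀ {Hs} →
  IsPacking D ⊤ Hs → m ≤ length Hs → HamiltonianDecomposition m
spanning-packing⇒decomposition {m} 1≤m {D} {Hs} packing m≤length = record
  { next          = λ v u → head {u} Subset.∈⊤ (index v)
  ; next-zero     = next-index
  ; next≢         = λ v u → head≢ {u} Subset.∈⊤ (index v)
  ; next-disjoint = λ v≢w u eq → v≢w (index-injective (head-injective {u} Subset.∈⊤ eq))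
  ; walk          = λ v x y → Star.map (λ {z} → only-head {z} Subset.∈⊤ (s≤s m≤length) (index v))
      (let _ , strong , ⊤⊆ = strong-at (index v) in strong x y (⊤⊆ Subset.∈⊤) (⊤⊆ Subset.∈⊤))
  }
  where
  2≤∣⊤∣ : 2 ≤ ∣ ⊤ {suc m} ∣
  2≤∣⊤∣ = subst (2 ≤_) (sym (Subset.∣⊤∣≡n (suc m))) (s≤s 1≤m)

  open Heads {D = D} packing 2≤∣⊤∣

  index : Fin m → Fin (length Hs)
  index v = proj₁ (head-surjective {zero} Subset.∈⊤ (s≤s m≤length) {suc v} λ ())

  next-index : ∀ v → head {zero} Subset.∈⊤ (index v) ≡ suc v
  next-index v = proj₂ (head-surjective {zero} Subset.∈⊤ (s≤s m≤length) {suc v} λ ())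

  index-injective : ∀ {v w} → index v ≡ index w → v ≡ w
  index-injective {v} {w} eq = Fin.suc-injective
    (trans (sym (next-index v)) (trans (cong (head {zero} Subset.∈⊤) eq) (next-index w)))

no-hamiltonianDecomposition : ∀ {m} → NoDecomposition m → ¬ HamiltonianDecomposition m
no-hamiltonianDecomposition {m} (by-search search) decomposition =
  exhausted-sound disjoint? (Vec.tabulate cycles) search table
    (λ v → subst (table v ∈_) (sym (Vec.lookup∘tabulate cycles v)) (table∈cycles v))
    (λ {v} {w} v≢w u eq → next-disjoint v≢w u (trans (sym (lookup-table v u)) (trans eq (lookup-table w u))))
  where
  open HamiltonianDecomposition decomposition

  table : Fin m → Table (suc m)
  table v = Vec.tabulate (next v)

  lookup-table : ∀ v u → Vec.lookup (table v) u ≡ next v u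
  lookup-table v = Vec.lookup∘tabulate (next v)

  connected : ∀ v → Connected (table v)
  connected v =
      -- A walk that returns to 0 ends with an arc into 0.
      (let x , eq = last-step (λ ()) (walk v (suc v) zero) in x , trans (lookup-table v x) eq)
    -- A closed orbit of 0 contains all that is reachable from 0, hence every vertex.
    , λ closed w → preserved (_∈ orbit (table v) (suc m) zero)
        (λ { {x} x∈ refl → subst (_∈ _) (lookup-table v x) (All.lookup closed x∈) })
        (walk v zero w) (here refl)

  table∈cycles : ∀ v → table v ∈ cycles v
  table∈cycles v = ∈-filter⁺ connected? (∈-choices rows) (connected v)
    where
    rows : ∀ u → next v u ∈ row v u
    rows zero    = here (next-zero v)
    rows (suc u) = ∈-filter⁺ (λ w → ¬? (w Fin.≟ suc u)) (∈-allFin _) (next≢ v (suc u))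

no-hamiltonianDecomposition-4-or-6 : ∀ {m} → suc m ∈ 4 ∷ 6 ∷ [] → ¬ HamiltonianDecomposition m
no-hamiltonianDecomposition-4-or-6 (here refl)         = no-hamiltonianDecomposition no-decomposition₄
no-hamiltonianDecomposition-4-or-6 (there (here refl)) = no-hamiltonianDecomposition no-decomposition₆

-- The bounds and the case of equality

subset-containing : ∀ {n k} (u : Fin n) → 1 ≤ k → k ≤ n → ∃ λ S → ∣ S ∣ ≡ k × u Subset.∈ S
subset-containing zero (s≤s _) (s≤s k≤n) with subset-of-size k≤n
... | S , eq = inside ∷ S , cong suc eq , Vec.here
subset-containing {suc n} {k} (suc u) 1≤k k≤1+n with k ℕ.≤? n
... | yes k≤n = let S , eq , u∈S = subset-containing u 1≤k k≤n in outside ∷ S , eq , Vec.there u∈S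
... | no  k≰n = ⊤ , trans (Subset.∣⊤∣≡n (suc n)) (ℕ.≤-antisym (ℕ.≰⇒> k≰n) k≤1+n) , Subset.∈⊤

-- λ-arc is used only through this characterisation, since its normal form
-- is far too large to be unfolded by the type checker.
record IsConnectivity {n} (k : ℕ) (D : Digraph n) (l : ℕ) : Set where
  field
    packing  : ∀ {S} → ∣ S ∣ ≡ k → ∃ λ Hs → IsPacking D S Hs × l ≤ length Hs
    greatest : ∀ {m} → (∀ {S} → ∣ S ∣ ≡ k → ∃ λ Hs → IsPacking D S Hs × length Hs ≡ m) → m ≤ l

λ-arc-isConnectivity : ∀ {n k} (D : Digraph n) → k ≤ n → IsConnectivity k D (λ-arc k D)
λ-arc-isConnectivity {k = k} D k≤n = record
  { packing  = λ {S} ∣S∣≡k →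
      let Hs , packing , length≡ = λ-set-attained D S
      in Hs , packing , ℕ.≤-trans (λ-arc-lower k D S ∣S∣≡k) (ℕ.≤-reflexive (sym length≡))
  ; greatest = λ packings →
      let S , ∣S∣≡k , λ-set≡λ-arc = λ-arc-attained {k = k} D k≤n
          Hs , packing , length≡m = packings ∣S∣≡k
      in subst₂ _≤_ length≡m λ-set≡λ-arc (λ-set-upper D S packing)
  }

Admissible : ℕ → ℕ → Set
Admissible n k = k ∉ 4 ∷ 6 ∷ [] ⊎ (k ∈ 4 ∷ 6 ∷ [] × k < n)

-- Turns the condition on k into what the constructions need: an order other than 4 and 6, or a
-- vertex outside S.
admissible⇒order-or-size : ∀ {n k} → k ≤ n → Admissible n k → (n ≢ 4 × n ≢ 6) ⊎ k < n
admissible⇒order-or-size k≤n (inj₂ (_ , k<n)) = inj₂ k<n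
admissible⇒order-or-size {n} {k} k≤n (inj₁ k∉) with k ≟ n
... | no  k≢n  = inj₂ (ℕ.≤∧≢⇒< k≤n k≢n)
... | yes refl = inj₁ ((λ { refl → k∉ (here refl) }) , (λ { refl → k∉ (there (here refl)) }))

module _ {q k l : ℕ} {D : Digraph (suc q)}
  (2≤k : 2 ≤ k) (k≤n : k ≤ suc q) (isConn : IsConnectivity k D l) where

  open IsConnectivity isConn

  private
    n : ℕ
    n = suc q

    2≤size : ∀ (S : Subset n) → ∣ S ∣ ≡ k → 2 ≤ ∣ S ∣
    2≤size S ∣S∣≡k = subst (2 ≤_) (sym ∣S∣≡k) 2≤k

  -- Every S of size k has a packing with at least l members, so it suffices to bound packings for
  -- one S through u.
  connectivity≤ : ∀ {d} u → (∀ {S Hs} → IsPacking D S Hs → 2 ≤ ∣ S ∣ → u Subset.∈ S → length Hs ≤ d) → l ≤ d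
  connectivity≤ u bound with subset-containing u (ℕ.<⇒≤ 2≤k) k≤n
  ... | S , ∣S∣≡k , u∈S with packing ∣S∣≡k
  ... | Hs , isPacking , l≤length = ℕ.≤-trans l≤length (bound isPacking (2≤size S ∣S∣≡k) u∈S)

  connectivity-upper : l ≤ q
  connectivity-upper = connectivity≤ zero λ {S} isPacking 2≤∣S∣ u∈S → s≤s⁻¹ (Heads.size-bound {D = D} {S} isPacking 2≤∣S∣ u∈S)

  -- D itself is a packing with one member, for every S.
  strong⇒1≤connectivity : Strong D → 1 ≤ l
  strong⇒1≤connectivity strong = greatest λ _ → H ∷ [] , ([] ∷ [] , H-strong ∷ [] , [] ∷ []) , refl
    where
    H = fromRelation ⊤ (arc? D)
    H-strong : ∀ {S} → IsStrongSubgraphContaining D S H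
    H-strong = (λ u v a → Subset.∈⊤ , Subset.∈⊤ , arc⁻ ⊤ (arc? D) u v a)
      , (λ u v _ _ → Star.map (arc⁺ ⊤ (arc? D)) (strong u v)) , Subset.⊆⊤

  -- The q members leave u through different arcs, whose heads are all the other vertices; u is
  -- arbitrary, since some S contains it.
  maximal⇒complete : l ≡ q → Complete D
  maximal⇒complete refl {u} u≢v with subset-containing u (ℕ.<⇒≤ 2≤k) k≤n
  ... | S , ∣S∣≡k , u∈S with packing ∣S∣≡k
  ... | Hs , isPacking , q≤length = subst (Arc D u) (proj₂ found) (head-arc u∈S (proj₁ found))
    where
    open Heads {D = D} {S} isPacking (2≤size S ∣S∣≡k)
    found = head-surjective u∈S (s≤s q≤length) (u≢v ∘ sym)

  -- Only k = n in {4, 6} has to be refuted. There S is the whole vertex set, and the packing would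
  -- yield a Hamiltonian decomposition.
  maximal⇒admissible : l ≡ q → Admissible n k
  maximal⇒admissible refl with k ∈? 4 ∷ 6 ∷ [] | k ≟ n
    where open DecMembership _≟_ using (_∈?_)
  ... | no  k∉ | _        = inj₁ k∉
  ... | yes k∈ | no  k≢n  = inj₂ (k∈ , ℕ.≤∧≢⇒< k≤n k≢n)
  ... | yes k∈ | yes refl with packing {⊤} (Subset.∣⊤∣≡n n)
  ... | Hs , isPacking , q≤length = contradiction
    (spanning-packing⇒decomposition (s≤s⁻¹ 2≤k) {D} isPacking q≤length) (no-hamiltonianDecomposition-4-or-6 k∈)

  complete⇒maximal : Complete D → Admissible n k → l ≡ q
  complete⇒maximal complete admissible = ℕ.≤-antisym connectivity-upper
    (greatest λ {S} ∣S∣≡k → complete-packing {D = D} {S} complete (2≤size S ∣S∣≡k)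
      (subst (λ s → (n ≢ 4 × n ≢ 6) ⊎ s < n) (sym ∣S∣≡k) (admissible⇒order-or-size k≤n admissible)))

-- Isomorphism with the complete digraph, and sharpness

complete⇒≅ : ∀ {n} {D : Digraph n} → Complete D → D ≅ completeDigraph n
complete⇒≅ {D = D} complete = record
  { bijection = Permutation.id
  ; preserves = λ u v → mk⇔ (λ a u≡v → loopless D u (subst (Arc D u) (sym u≡v) a)) complete
  }

≅⇒complete : ∀ {n} {D : Digraph n} → D ≅ completeDigraph n → Complete D
≅⇒complete D≅K {u} {v} u≢v = Equivalence.from (preserves u v) (u≢v ∘ injective)
  where
  open _≅_ D≅K
  injective : ∀ {u v} → bijection Permutation.⟨$⟩ʳ u ≡ bijection Permutation.⟨$⟩ʳ v → u ≡ v
  injective eq = trans (sym (Permutation.inverseˡ bijection)) (trans (cong (bijection Permutation.⟨$⟩ˡ_) eq) (Permutation.inverseˡ bijection))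

starDigraph : ∀ n → Digraph (suc n)
starDigraph n = record
  { Arc      = StarArc zero
  ; arc?     = starArc? zero
  ; loopless = λ v a → starArc-irrefl a refl
  }

-- A leaf has a single out-neighbour, so for an S containing a leaf all members of a packing compete
-- for one arc.
starDigraph-connectivity : ∀ {m k l} → 2 ≤ k → k ≤ suc (suc m) →
  IsConnectivity k (starDigraph (suc m)) l → l ≡ 1
starDigraph-connectivity {m} 2≤k k≤n isConn = ℕ.≤-antisym
  (connectivity≤ 2≤k k≤n isConn leaf one-head) (strong⇒1≤connectivity 2≤k k≤n isConn (star-connected zero))
  where
  D = starDigraph (suc m)
  leaf : Fin (suc (suc m))
  leaf = suc zero
  leaf-head : ∀ {v} → Arc D leaf v → v ≡ zero
  leaf-head (inj₂ (_ , v≡0)) = v≡0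
  one-head : ∀ {S Hs} → IsPacking D S Hs → 2 ≤ ∣ S ∣ → leaf Subset.∈ S → length Hs ≤ 1
  -- All heads at the leaf are the centre, so even the constant map from the members to `Fin 1` is
  -- injective.
  one-head {S} isPacking 2≤∣S∣ u∈S = Fin.injective⇒≤ {n = 1} {f = λ _ → zero} λ {h} {h′} _ →
    head-injective u∈S (trans (leaf-head (head-arc u∈S h)) (sym (leaf-head (head-arc u∈S h′))))
    where open Heads {D = D} {S} isPacking 2≤∣S∣

theorem3p6 : ∀ (n k : ℕ) → 2 ≤ k → k ≤ n →
  (∀ (D : Digraph n) → Strong D →
    (1 ≤ λ-arc k D × λ-arc k D ≤ n ∸ 1)
    × (λ-arc k D ≡ n ∸ 1 ⇔
        (D ≅ completeDigraph n
         × (k ∉ 4 ∷ 6 ∷ [] ⊎ (k ∈ 4 ∷ 6 ∷ [] × k < n)))))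
  -- both bounds are sharp; the upper one is not attained when k ≡ n is 4 or 6
  × (∃[ D ] (Strong {n} D × λ-arc k D ≡ 1))
  × ((k ∉ 4 ∷ 6 ∷ [] ⊎ (k ∈ 4 ∷ 6 ∷ [] × k < n)) →
      ∃[ D ] (Strong {n} D × λ-arc k D ≡ n ∸ 1))
theorem3p6 zero          _ (s≤s _) ()
theorem3p6 (suc zero)    _ (s≤s (s≤s _)) (s≤s ())
theorem3p6 n@(suc (suc m)) k 2≤k k≤n =
    (λ D strong → (strong⇒1≤connectivity 2≤k k≤n (conn D) strong , connectivity-upper 2≤k k≤n (conn D))
      , mk⇔ (λ λ≡ → complete⇒≅ (maximal⇒complete 2≤k k≤n (conn D) λ≡) , maximal⇒admissible 2≤k k≤n (conn D) λ≡)
            (λ (D≅K , admissible) → complete⇒maximal 2≤k k≤n (conn D) (≅⇒complete D≅K) admissible))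
  , (starDigraph (suc m) , star-connected zero , starDigraph-connectivity 2≤k k≤n (conn (starDigraph (suc m))))
  , λ admissible → completeDigraph n , complete-strong
      , complete⇒maximal 2≤k k≤n (conn (completeDigraph n)) id admissible
  where
  conn : ∀ (D : Digraph n) → IsConnectivity k D (λ-arc k D)
  conn D = λ-arc-isConnectivity D k≤n
  complete-strong : Strong (completeDigraph n)
  complete-strong u v with u Fin.≟ v
  ... | yes refl = ε
  ... | no  u≢v  = u≢v ◅ ε
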